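{- Let $G$ be an $\mathsf{LL}(k)$ grammar with terminal alphabet $\Sigma$. There is a randomized one-pass streaming algorithm that, given an input $w \in \Sigma^n$ and a positive integer $b$, uses space $O(b \log n)$ (where the hidden constant depends on the grammar $G$, including on $k$) and (1) accepts with probability $1$ if $w \in L(G)$ and $\mathrm{rank}_G(w) \leq b$; (2) rejects with probability at least $1 - \frac{1}{n}$ if $w \notin L(G)$ or $\mathrm{rank}_G(w) > b$.
   Context: For a context-free grammar $G=(N,\Sigma,P,S)$ and $w\in\Sigma^*$, let $\mathrm{pref}_k(w)$ be the first $k$ characters of $w$ if $|w|>k$, and $w$ otherwise. The select set of a production $A \rightarrow \alpha$ ($A\in N$, $\alpha\in(N\cup\Sigma)^*$) is $\mathrm{SELECT}(A\rightarrow\alpha)=\{u : \exists v, w\in\Sigma^*,\ \alpha v \text{ derives } w \text{ and } \mathrm{pref}_k(w)=u\}$. $G$ is an $\mathsf{LL}(k)$ grammar if for any two distinct productions $A\rightarrow\alpha$, $A\rightarrow\beta$ with the same left-hand side, their select sets are disjoint. For $w\in L(G)$, $\mathrm{rank}_G(w)$ is the maximum number of nonterminals in any sentential form arising in the (unique) leftmost derivation of $w$. A one-pass streaming algorithm reads the input once from left to right (knowing $n$); its space is the number of bits of working memory used. -}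

module Defs where

open import Data.Nat using (ℕ; zero; suc; _+_; _*_; _^_; _≤_; _<_)
open import Data.Nat.Logarithm using (⌊log₂_⌋)
open import Data.Fin using (Fin)
open import Data.Bool using (Bool; true; false; if_then_else_)
open import Data.List using (List; []; _∷_; _++_; map; take; concatMap; length)
open import Data.Nat.ListAction using (sum)
open import Data.List.Membership.Propositional using (_∈_)
open import Data.List.Relation.Unary.All using (All)
open import Data.Vec using (Vec; toList) renaming ([] to []v; _∷_ to _∷v_)
open import Data.Sum using (_⊎_; inj₁; inj₂)
open import Data.Product using (Σ; _×_; _,_; ∃)
open import Relation.Binary.PropositionalEquality using (_≡_; _≢_)
open import Relation.Binary.Construct.Closure.ReflexiveTransitive using (Star)
open import Relation.Nullary using (¬_)
open import Data.Empty using (⊥)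

record Grammar (T : ℕ) : Set where
  field
    nN : ℕ
    P  : List (Fin nN × List (Fin nN ⊎ Fin T))
    S  : Fin nN

module _ {T : ℕ} (G : Grammar T) where
  open Grammar G

  Sym : Set
  Sym = Fin nN ⊎ Fin T

  SF : Set
  SF = List Sym

  terminals : List (Fin T) → SF
  terminals = map inj₂

  data Step : SF → SF → Set where
    derivStep : ∀ (x : SF) (A : Fin nN) (α y : SF) → (A , α) ∈ P →
           Step (x ++ inj₁ A ∷ y) (x ++ α ++ y)

  Derives : SF → SF → Set
  Derives = Star Step

  data LMStep : SF → SF → Set where
    lmstep : ∀ (u : List (Fin T)) (A : Fin nN) (α β : SF) → (A , α) ∈ P →
             LMStep (terminals u ++ inj₁ A ∷ β) (terminals u ++ α ++ β)

  data LMSeq : SF → SF → List SF → Set where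
    done : ∀ γ → LMSeq γ γ (γ ∷ [])
    more : ∀ γ δ ε forms → LMStep γ δ → LMSeq δ ε forms → LMSeq γ ε (γ ∷ forms)

  countNT : SF → ℕ
  countNT [] = 0
  countNT (inj₁ _ ∷ γ) = suc (countNT γ)
  countNT (inj₂ _ ∷ γ) = countNT γ

  pref : ℕ → List (Fin T) → List (Fin T)
  pref = take

  Select : ℕ → SF → List (Fin T) → Set
  Select k α u = Σ (List (Fin T)) λ v → Σ (List (Fin T)) λ w →
    Derives (α ++ terminals v) (terminals w) × pref k w ≡ u

  IsLL : ℕ → Set
  IsLL k = ∀ (A : Fin nN) (α β : SF) → (A , α) ∈ P → (A , β) ∈ P → α ≢ β →
           ∀ u → Select k α u → Select k β u → ⊥

  -- w ∈ L(G) and rank_G(w) ≤ b : there is a leftmost derivation of w from S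
  -- all of whose sentential forms contain at most b nonterminals
  -- (for LL(k) grammars the leftmost derivation is unique).
  InLangRankAtMost : ℕ → List (Fin T) → Set
  InLangRankAtMost b w = Σ (List SF) λ forms →
    LMSeq (inj₁ S ∷ []) (terminals w) forms × All (λ γ → countNT γ ≤ b) forms

-- Randomized one-pass streaming algorithms over the alphabet Fin T.
-- For input length n and parameter b, the working memory consists of
-- exactly  space n b  bits.  Before reading the input, and when reading
-- each symbol, the algorithm receives a fresh block of  coins n b
-- uniformly random bits (which it must store in memory if it wants to
-- keep them).  Being Agda functions, init/step/accept are computable.

record StreamingAlg (T : ℕ) : Set where
  field
    space  : ℕ → ℕ → ℕ
    coins  : ℕ → ℕ → ℕ
    init   : ∀ n b → Vec Bool (coins n b) → Vec Bool (space n b)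
    step   : ∀ n b → Vec Bool (space n b) → Fin T → Vec Bool (coins n b) →
             Vec Bool (space n b)
    accept : ∀ n b → Vec Bool (space n b) → Bool

allVec : {A : Set} → List A → (m : ℕ) → List (Vec A m)
allVec xs zero = []v ∷ []
allVec xs (suc m) = concatMap (λ x → map (x ∷v_) (allVec xs m)) xs

allBits : (m : ℕ) → List (Vec Bool m)
allBits = allVec (false ∷ true ∷ [])

module _ {T : ℕ} (M : StreamingAlg T) where
  open StreamingAlg M

  feed : ∀ n b {m} → Vec Bool (space n b) → Vec (Fin T) m →
         Vec (Vec Bool (coins n b)) m → Vec Bool (space n b)
  feed n b s []v []v = s
  feed n b s (a ∷v w) (r ∷v rs) = feed n b (step n b s a r) w rs

  run : ∀ n b → Vec (Fin T) n → Vec (Vec Bool (coins n b)) (suc n) → Bool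
  run n b w (r₀ ∷v rs) = accept n b (feed n b (init n b r₀) w rs)

  randomStrings : ∀ n b → List (Vec (Vec Bool (coins n b)) (suc n))
  randomStrings n b = allVec (allBits (coins n b)) (suc n)

  totalRuns : ℕ → ℕ → ℕ
  totalRuns n b = length (randomStrings n b)

  -- number of random strings on which the algorithm accepts w;
  -- Pr[accept w] = acceptCount / totalRuns
  acceptCount : ∀ n b → Vec (Fin T) n → ℕ
  acceptCount n b w =
    sum (map (λ r → if run n b w r then 1 else 0) (randomStrings n b))

module Submission where

-- The algorithm simulates the deterministic leftmost derivation steered by a
-- window of k input symbols.  The production for a nonterminal A under the
-- window u is determined by which α can derive a word compatible with u, and
-- that is decidable (Bar-Hillel: emptiness of a grammar intersected with a
-- finite automaton).  Only the at most b nonterminals of the sentential form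
-- are kept; each run of terminals between them is replaced by its length and
-- by the value of its polynomial fingerprint at a random point r.  The derived
-- word is never compared with the input letter by letter: both are
-- fingerprinted and compared once, at the end.  Running the same machine with
-- words in place of fingerprints shows that the derived word depends on the
-- input only and, if the run ends well, lies in the language with rank at most
-- b.  So a wrong acceptance means that r is a root of a fixed nonzero
-- polynomial of degree below n.
--
-- The fingerprints need an integral domain with n² points and elements of
-- O(log n) bits.  To avoid searching for primes it is taken from the tower of
-- quadratic extensions of 𝔽₅ obtained by repeatedly adjoining square roots.

open import Defs
open import Level using (0ℓ)
open import Algebra.Bundles using (CommutativeRing)
open import Algebra.Structures using (IsCommutativeRing)
import Algebra.Solver.Ring.NaturalCoefficients.Default as RingSolver
open import Data.Bool using (Bool; true; false; if_then_else_)
import Data.Bool.Properties as Boolₚ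
open import Data.Empty using (⊥-elim)
open import Data.Fin as Fin using (Fin; zero; suc; toℕ; fromℕ<; combine; remQuot; finToFun; funToFin)
open import Data.Fin.Patterns
import Data.Fin.Properties as Finₚ
open import Data.List using (List; []; _∷_; length)
import Data.List.Properties as Listₚ
open import Data.List.Membership.Propositional using (_∈_; find; lose)
open import Data.List.Relation.Unary.All as All using (All; []; _∷_)
import Data.List.Relation.Unary.All.Properties as Allₚ
open import Data.List.Relation.Unary.AllPairs using ([]; _∷_)
open import Data.List.Relation.Unary.Any using (Any; any?)
open import Data.List.Relation.Unary.Unique.Propositional using (Unique)
import Data.List.Relation.Unary.Unique.Propositional.Properties as Uniqueₚ
open import Data.Maybe as Maybe using (Maybe; just; nothing; _>>=_)
open import Data.Maybe.Properties using (just-injective)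
import Data.Maybe.Relation.Unary.All as MAll
open import Data.Nat as ℕ using (ℕ; zero; suc; s≤s; z≤n)
open import Data.Nat.DivMod using (_mod_)
open import Data.Nat.GeneralisedArithmetic using (fold; fold-+)
open import Data.Nat.ListAction using (sum)
open import Data.Nat.ListAction.Properties using (sum-++)
open import Data.Nat.Logarithm using (⌊log₂_⌋; ⌊log₂⌋-mono-≤; ⌊log₂[2^n]⌋≡n)
import Data.Nat.Properties as ℕₚ
open import Data.Product using (Σ; _×_; _,_; proj₁; proj₂; ∃-syntax)
import Data.Product.Properties as ×ₚ
open import Data.Sum as Sum using (_⊎_; inj₁; inj₂)
import Data.Sum.Properties as ⊎ₚ
open import Data.Unit using (⊤; tt)
open import Data.Vec as Vec using (Vec; tabulate; lookup; toList) renaming ([] to []v; _∷_ to _∷v_)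
import Data.Vec.Properties as Vecₚ
open import Function using (_∘_; id; Inverse; Equivalence)
open import Relation.Binary.Construct.Closure.ReflexiveTransitive as Star using (_◅_; _◅◅_)
open import Relation.Binary.Definitions using (DecidableEquality)
open import Relation.Binary.PropositionalEquality
open import Relation.Nullary using (¬_; Dec; yes; no; contradiction; does)
open import Relation.Nullary.Decidable using (_×-dec_; _→-dec_; _⊎-dec_; dec-true; from-yes; map′)

-- Fixed-length binary encodings, and orbits in finite sets.

module Codes where
  open import Data.Nat
  open import Data.Nat.Properties
  open import Data.Vec using ([]; _∷_; _++_; replicate)

  fromBits : ∀ {m} → Vec Bool m → Fin (2 ^ m)
  fromBits v = funToFin (Inverse.from Finₚ.2↔Bool ∘ lookup v)

  toBits : ∀ {m} → Fin (2 ^ m) → Vec Bool m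
  toBits i = tabulate (Inverse.to Finₚ.2↔Bool ∘ finToFun i)

  toBits-fromBits : ∀ {m} (v : Vec Bool m) → toBits (fromBits v) ≡ v
  toBits-fromBits v = trans
    (Vecₚ.tabulate-cong λ j → trans
      (cong (Inverse.to Finₚ.2↔Bool) (Finₚ.finToFun-funToFin (Inverse.from Finₚ.2↔Bool ∘ lookup v) j))
      (Inverse.strictlyInverseˡ Finₚ.2↔Bool (lookup v j)))
    (Vecₚ.tabulate∘lookup v)

  fromBits-toBits : ∀ {m} (i : Fin (2 ^ m)) → fromBits (toBits {m} i) ≡ i
  fromBits-toBits {m} i = trans (funToFin-cong {m} λ j → trans
      (cong (Inverse.from Finₚ.2↔Bool) (Vecₚ.lookup∘tabulate (Inverse.to Finₚ.2↔Bool ∘ finToFun {2} {m} i) j))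
      (Inverse.strictlyInverseʳ Finₚ.2↔Bool (finToFun {2} {m} i j)))
    (Finₚ.funToFin-finToFin {m} i)
    where
    funToFin-cong : ∀ {k l} {f g : Fin k → Fin l} → (∀ j → f j ≡ g j) → funToFin f ≡ funToFin g
    funToFin-cong {zero}  eq = refl
    funToFin-cong {suc k} eq = cong₂ Fin.combine (eq Fin.zero) (funToFin-cong (eq ∘ Fin.suc))

  -- Only values satisfying `Fits` must survive the round trip. Thus `enc` can be total on an
  -- infinite type, and the size bounds are proved apart from the encoding.
  record Code {X : Set} (Fits : X → Set) (m : ℕ) : Set where
    field
      enc     : X → Vec Bool m
      dec     : Vec Bool m → Maybe X
      dec-enc : ∀ {x} → Fits x → dec (enc x) ≡ just x

  open Code

  trivial : {X : Set} → X → Set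
  trivial _ = ⊤

  bitsC : ∀ m → Code {Vec Bool m} trivial m
  bitsC m .enc v = v
  bitsC m .dec = just
  bitsC m .dec-enc _ = refl

  natC : ∀ m → Code (_< 2 ^ m) m
  natC m .enc x with x <? 2 ^ m
  ... | yes lt = toBits (fromℕ< lt)
  ... | no  _  = replicate m false
  natC m .dec v = just (toℕ (fromBits v))
  natC m .dec-enc {x} lt with x <? 2 ^ m
  ... | yes lt′ = cong just (trans (cong toℕ (fromBits-toBits {m} (fromℕ< lt′))) (Finₚ.toℕ-fromℕ< lt′))
  ... | no ¬lt  = contradiction lt ¬lt

  retractC : ∀ {X Y : Set} {P : X → Set} {Q : Y → Set} {m} (f : Y → X) (g : X → Maybe Y) →
             (∀ {y} → Q y → P (f y) × g (f y) ≡ just y) → Code P m → Code Q m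
  retractC f g fg c .enc = c .enc ∘ f
  retractC f g fg c .dec v = c .dec v >>= g
  retractC f g fg c .dec-enc qy rewrite c .dec-enc (proj₁ (fg qy)) = proj₂ (fg qy)

  finC : ∀ {n m} → n ≤ 2 ^ m → Code {Fin n} trivial m
  finC {n} {m} n≤ = retractC toℕ g (λ {i} _ → <-≤-trans (Finₚ.toℕ<n i) n≤ , g-toℕ i) (natC m)
    where
    g : ℕ → Maybe (Fin n)
    g x with x <? n
    ... | yes lt = just (fromℕ< lt)
    ... | no  _  = nothing
    g-toℕ : ∀ i → g (toℕ i) ≡ just i
    g-toℕ i with toℕ i <? n
    ... | yes lt = cong just (Finₚ.fromℕ<-toℕ i lt)
    ... | no ¬lt = contradiction (Finₚ.toℕ<n i) ¬lt

  _×C_ : ∀ {X Y : Set} {P : X → Set} {Q : Y → Set} {m l} → Code P m → Code Q l →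
         Code {X × Y} (λ xy → P (proj₁ xy) × Q (proj₂ xy)) (m + l)
  _×C_ c d .enc (x , y) = c .enc x ++ d .enc y
  _×C_ {m = m} c d .dec v = c .dec (Vec.take m v) >>= λ x → d .dec (Vec.drop m v) >>= λ y → just (x , y)
  _×C_ {m = m} c d .dec-enc {x , y} (px , qy)
    with p , q ← Vecₚ.++-injective (Vec.take m (c .enc x ++ d .enc y)) (c .enc x) (Vecₚ.take++drop≡id m (c .enc x ++ d .enc y))
    rewrite p | q | c .dec-enc px | d .dec-enc qy = refl

  maybeC : ∀ {X : Set} {P : X → Set} {m} → Code P m → Code (MAll.All P) (suc m)
  maybeC {m = m} c .enc nothing  = false ∷ replicate m false
  maybeC c .enc (just x) = true ∷ c .enc x
  maybeC c .dec (false ∷ _) = just nothing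
  maybeC c .dec (true ∷ v)  = Maybe.map just (c .dec v)
  maybeC c .dec-enc {nothing} _ = refl
  maybeC c .dec-enc {just x} (MAll.just px) rewrite c .dec-enc px = refl

  module _ {X : Set} {P : X → Set} {m : ℕ} (c : Code P m) where

    private
      encL : ∀ b → List X → Vec Bool (b * suc m)
      encL b [] = replicate _ false
      encL zero (_ ∷ _) = []
      encL (suc b) (x ∷ xs) = (true ∷ c .enc x) ++ encL b xs

      decL : ∀ b → Vec Bool (b * suc m) → Maybe (List X)
      decL zero _ = just []
      decL (suc b) (false ∷ _) = just []
      decL (suc b) (true ∷ v) = c .dec (Vec.take m v) >>= λ x → decL b (Vec.drop m v) >>= λ xs → just (x ∷ xs)

      decL-encL : ∀ b xs → length xs ≤ b → All P xs → decL b (encL b xs) ≡ just xs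
      decL-encL zero [] _ _ = refl
      decL-encL (suc b) [] _ _ = refl
      decL-encL (suc b) (x ∷ xs) (s≤s le) (px ∷ pxs)
        with p , q ← Vecₚ.++-injective (Vec.take m (c .enc x ++ encL b xs)) (c .enc x) (Vecₚ.take++drop≡id m (c .enc x ++ encL b xs))
        rewrite p | q | c .dec-enc px | decL-encL b xs le pxs = refl

    -- Each of the `b` slots begins with a bit telling whether it is occupied, and decoding stops at
    -- the first free slot.
    listC : ∀ b → Code (λ xs → length xs ≤ b × All P xs) (b * suc m)
    listC b .enc = encL b
    listC b .dec = decL b
    listC b .dec-enc {xs} (le , ps) = decL-encL b xs le ps

  -- If two of the first 2 ^ m iterates coincide, a later hit can be moved
  -- back by the period.
  orbit-hit : ∀ {X : Set} {P : X → Set} {m} → Code P m → (g : X → X) (x : X) →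
              (∀ i → P (fold x g i)) → (Q : X → Set) →
              ∀ t → Q (fold x g t) → ∃[ t′ ] t′ < 2 ^ m × Q (fold x g t′)
  orbit-hit {m = m} c g x Px Q t = go t t ≤-refl
    where
    open ≡-Reasoning
    go : ∀ bound t → t ≤ bound → Q (fold x g t) → ∃[ t′ ] t′ < 2 ^ m × Q (fold x g t′)
    go bound t t≤ q with t <? 2 ^ m
    ... | yes lt = t , lt , q
    ... | no ¬lt with Finₚ.pigeonhole {2 ^ m} {suc (2 ^ m)} ≤-refl (λ i → fromBits (c .enc (fold x g (toℕ i))))
    go zero t t≤ q | no ¬lt | _ = contradiction (≤-trans (s≤s t≤) (m^n>0 2 m)) ¬lt
    go (suc bound) t t≤ q | no ¬lt | i , j , i<j , eq = go bound (t ∸ toℕ j + toℕ i) smaller (subst Q same q)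
      where
      j≤t : toℕ j ≤ t
      j≤t = ≤-trans (≤-pred (Finₚ.toℕ<n j)) (≮⇒≥ ¬lt)
      smaller : t ∸ toℕ j + toℕ i ≤ bound
      smaller = ≤-pred (≤-trans (+-monoʳ-< (t ∸ toℕ j) i<j) (≤-trans (≤-reflexive (m∸n+n≡m j≤t)) t≤))
      enc-eq : c .enc (fold x g (toℕ i)) ≡ c .enc (fold x g (toℕ j))
      enc-eq = trans (sym (toBits-fromBits _)) (trans (cong toBits eq) (toBits-fromBits _))
      iter-eq : fold x g (toℕ j) ≡ fold x g (toℕ i)
      iter-eq = just-injective (trans (sym (c .dec-enc (Px (toℕ j)))) (trans (cong (c .dec) (sym enc-eq)) (c .dec-enc (Px (toℕ i)))))
      same : fold x g t ≡ fold x g (t ∸ toℕ j + toℕ i)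
      same = begin
        fold x g t                              ≡⟨ cong (fold x g) (m∸n+n≡m j≤t) ⟨
        fold x g (t ∸ toℕ j + toℕ j)            ≡⟨ fold-+ x g (t ∸ toℕ j) ⟩
        fold (fold x g (toℕ j)) g (t ∸ toℕ j)   ≡⟨ cong (λ y → fold y g (t ∸ toℕ j)) iter-eq ⟩
        fold (fold x g (toℕ i)) g (t ∸ toℕ j)   ≡⟨ fold-+ x g (t ∸ toℕ j) ⟨
        fold x g (t ∸ toℕ j + toℕ i)            ∎

open Codes

-- Finite integral domains from a tower of quadratic extensions.

module Domains where
  open import Data.List using (_++_; map; zipWith)
  open import Data.Vec using ([]; _∷_)

  -- The form u² - θv² vanishes only at zero by `θ-nonsquare`; the square root `ι` of -1 is what
  -- carries this property to the next extension. `point` names just 2 ^ dim of the elements, so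
  -- that uniform coins select uniform points.
  record Domain : Set₁ where
    infixl 7 _*_
    infixl 6 _+_
    field
      Carrier : Set
      _+_ _*_ : Carrier → Carrier → Carrier
      -_      : Carrier → Carrier
      0# 1#   : Carrier
      isCommutativeRing : IsCommutativeRing _≡_ _+_ _*_ -_ 0# 1#
      _≟_      : DecidableEquality Carrier
      integral : ∀ {x y} → x * y ≡ 0# → x ≡ 0# ⊎ y ≡ 0#
      ι        : Carrier
      ι²≡-1    : ι * ι ≡ - 1#
      θ        : Carrier
      θ-nonsquare : ∀ {u v} → u * u ≡ θ * (v * v) → v ≡ 0#
      dim      : ℕ
      point    : Vec Bool dim → Carrier
      point-injective : ∀ {v w} → point v ≡ point w → v ≡ w
      code     : Code {Carrier} trivial (3 ℕ.* dim)

    commutativeRing : CommutativeRing 0ℓ 0ℓ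
    commutativeRing = record { isCommutativeRing = isCommutativeRing }

    open CommutativeRing commutativeRing public
      hiding (Carrier; _+_; _*_; -_; 0#; 1#; isCommutativeRing; refl; sym; trans; reflexive; setoid; isEquivalence)

    open import Algebra.Properties.Ring (CommutativeRing.ring commutativeRing) public
      using (-‿distribʳ-*; -0#≈0#; -1*x≈-x; -‿involutive; [y-z]x≈yx-zx; +-cancelʳ)
    open import Algebra.Properties.Group (CommutativeRing.+-group commutativeRing) public
      using (x≈y⇒x∙y⁻¹≈ε; x∙y⁻¹≈ε⇒x≈y; inverseʳ-unique)

  -- Modulo 5 the squares are 0, 1 and 4, so 2 is a nonsquare, while its own square is -1. The ring
  -- laws are verified by exhausting all cases.
  𝔽₅ : Domain
  𝔽₅ = record
    { Carrier = Fin 5 ; _+_ = add ; _*_ = mul ; -_ = neg ; 0# = 0F ; 1# = 1F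
    ; isCommutativeRing = record
      { isRing = record
        { +-isAbelianGroup = record
          { isGroup = record
            { isMonoid = record
              { isSemigroup = record
                { isMagma = record { isEquivalence = isEquivalence ; ∙-cong = cong₂ add }
                ; assoc = from-yes (Finₚ.all? λ x → Finₚ.all? λ y → Finₚ.all? λ z → add (add x y) z Finₚ.≟ add x (add y z)) }
              ; identity = from-yes (Finₚ.all? λ x → add 0F x Finₚ.≟ x) , from-yes (Finₚ.all? λ x → add x 0F Finₚ.≟ x) }
            ; inverse = from-yes (Finₚ.all? λ x → add (neg x) x Finₚ.≟ 0F) , from-yes (Finₚ.all? λ x → add x (neg x) Finₚ.≟ 0F)
            ; ⁻¹-cong = cong neg }
          ; comm = from-yes (Finₚ.all? λ x → Finₚ.all? λ y → add x y Finₚ.≟ add y x) }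
        ; *-cong = cong₂ mul
        ; *-assoc = from-yes (Finₚ.all? λ x → Finₚ.all? λ y → Finₚ.all? λ z → mul (mul x y) z Finₚ.≟ mul x (mul y z))
        ; *-identity = from-yes (Finₚ.all? λ x → mul 1F x Finₚ.≟ x) , from-yes (Finₚ.all? λ x → mul x 1F Finₚ.≟ x)
        ; distrib = from-yes (Finₚ.all? λ x → Finₚ.all? λ y → Finₚ.all? λ z → mul x (add y z) Finₚ.≟ add (mul x y) (mul x z))
                  , from-yes (Finₚ.all? λ x → Finₚ.all? λ y → Finₚ.all? λ z → mul (add y z) x Finₚ.≟ add (mul y x) (mul z x)) }
      ; *-comm = from-yes (Finₚ.all? λ x → Finₚ.all? λ y → mul x y Finₚ.≟ mul y x) }
    ; _≟_ = Finₚ._≟_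
    ; integral = λ {x} {y} → from-yes (Finₚ.all? λ x → Finₚ.all? λ y → (mul x y Finₚ.≟ 0F) →-dec ((x Finₚ.≟ 0F) ⊎-dec (y Finₚ.≟ 0F))) x y
    ; ι = 2F ; ι²≡-1 = refl
    ; θ = 2F
    ; θ-nonsquare = λ {u} {v} → from-yes (Finₚ.all? λ u → Finₚ.all? λ v → (mul u u Finₚ.≟ mul 2F (mul v v)) →-dec (v Finₚ.≟ 0F)) u v
    ; dim = 1
    ; point = λ { (b ∷ []) → if b then 1F else 0F }
    ; point-injective = λ { {false ∷ []} {false ∷ []} _ → refl ; {true ∷ []} {true ∷ []} _ → refl ; {false ∷ []} {true ∷ []} () ; {true ∷ []} {false ∷ []} () }
    ; code = finC (ℕₚ.m≤m+n 5 3)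
    }
    where
    add mul : Fin 5 → Fin 5 → Fin 5
    add x y = (toℕ x ℕ.+ toℕ y) mod 5
    mul x y = (toℕ x ℕ.* toℕ y) mod 5
    neg : Fin 5 → Fin 5
    neg x = (5 ℕ.∸ toℕ x) mod 5

  -- The extension D(√θ).  Its θ is √θ: were it a square up to squares, then
  -- taking norms (N √θ = - θ, and - 1 is a square) so would be θ.
  module _ (D : Domain) where
    open Domain D
    open ≡-Reasoning

    open RingSolver commutativeSemiring using (solve; _:=_; _:+_; _:*_; con)

    private
      K : Set
      K = Carrier × Carrier

      _⊕_ _⊗_ : K → K → K
      (u , v) ⊕ (s , t) = u + s , v + t
      (u , v) ⊗ (s , t) = u * s + θ * (v * t) , u * t + v * s

      ⊖_ : K → K
      ⊖ (u , v) = - u , - v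

      assoc₁ : ∀ a u v s t p q → (u * s + a * (v * t)) * p + a * ((u * t + v * s) * q)
                               ≡ u * (s * p + a * (t * q)) + a * (v * (s * q + t * p))
      assoc₁ = solve 7 (λ a u v s t p q → ((u :* s :+ a :* (v :* t)) :* p :+ a :* ((u :* t :+ v :* s) :* q)) := (u :* (s :* p :+ a :* (t :* q)) :+ a :* (v :* (s :* q :+ t :* p)))) refl
      assoc₂ : ∀ a u v s t p q → (u * s + a * (v * t)) * q + (u * t + v * s) * p
                               ≡ u * (s * q + t * p) + v * (s * p + a * (t * q))
      assoc₂ = solve 7 (λ a u v s t p q → ((u :* s :+ a :* (v :* t)) :* q :+ (u :* t :+ v :* s) :* p) := (u :* (s :* q :+ t :* p) :+ v :* (s :* p :+ a :* (t :* q)))) refl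
      comm₁ : ∀ a u v s t → u * s + a * (v * t) ≡ s * u + a * (t * v)
      comm₁ = solve 5 (λ a u v s t → (u :* s :+ a :* (v :* t)) := (s :* u :+ a :* (t :* v))) refl
      comm₂ : ∀ u v s t → u * t + v * s ≡ s * v + t * u
      comm₂ = solve 4 (λ u v s t → (u :* t :+ v :* s) := (s :* v :+ t :* u)) refl
      dist₁ : ∀ a u v s t p q → u * (s + p) + a * (v * (t + q)) ≡ (u * s + a * (v * t)) + (u * p + a * (v * q))
      dist₁ = solve 7 (λ a u v s t p q → (u :* (s :+ p) :+ a :* (v :* (t :+ q))) := ((u :* s :+ a :* (v :* t)) :+ (u :* p :+ a :* (v :* q)))) refl
      dist₂ : ∀ u v s t p q → u * (t + q) + v * (s + p) ≡ (u * t + v * s) + (u * q + v * p)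
      dist₂ = solve 6 (λ u v s t p q → (u :* (t :+ q) :+ v :* (s :+ p)) := ((u :* t :+ v :* s) :+ (u :* q :+ v :* p))) refl
      id₁ : ∀ a u v → 1# * u + a * (0# * v) ≡ u
      id₁ = solve 3 (λ a u v → (con 1 :* u :+ a :* (con 0 :* v)) := (u)) refl
      id₂ : ∀ u v → 1# * v + 0# * u ≡ v
      id₂ = solve 2 (λ u v → (con 1 :* v :+ con 0 :* u) := (v)) refl

      ⊗-comm : ∀ x y → x ⊗ y ≡ y ⊗ x
      ⊗-comm (u , v) (s , t) = cong₂ _,_ (comm₁ θ u v s t) (comm₂ u v s t)
      ⊗-identityˡ : ∀ x → (1# , 0#) ⊗ x ≡ x
      ⊗-identityˡ (u , v) = cong₂ _,_ (id₁ θ u v) (id₂ u v)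
      ⊗-distribˡ : ∀ x y z → x ⊗ (y ⊕ z) ≡ (x ⊗ y) ⊕ (x ⊗ z)
      ⊗-distribˡ (u , v) (s , t) (p , q) = cong₂ _,_ (dist₁ θ u v s t p q) (dist₂ u v s t p q)

      isCR : IsCommutativeRing _≡_ _⊕_ _⊗_ ⊖_ (0# , 0#) (1# , 0#)
      isCR = record
        { isRing = record
          { +-isAbelianGroup = record
            { isGroup = record
              { isMonoid = record
                { isSemigroup = record
                  { isMagma = record { isEquivalence = isEquivalence ; ∙-cong = cong₂ _⊕_ }
                  ; assoc = λ { (u , v) (s , t) (p , q) → cong₂ _,_ (+-assoc u s p) (+-assoc v t q) } }
                ; identity = (λ { (u , v) → cong₂ _,_ (+-identityˡ u) (+-identityˡ v) })
                           , (λ { (u , v) → cong₂ _,_ (+-identityʳ u) (+-identityʳ v) }) }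
              ; inverse = (λ { (u , v) → cong₂ _,_ (-‿inverseˡ u) (-‿inverseˡ v) })
                        , (λ { (u , v) → cong₂ _,_ (-‿inverseʳ u) (-‿inverseʳ v) })
              ; ⁻¹-cong = cong ⊖_ }
            ; comm = λ { (u , v) (s , t) → cong₂ _,_ (+-comm u s) (+-comm v t) } }
          ; *-cong = cong₂ _⊗_
          ; *-assoc = λ { (u , v) (s , t) (p , q) → cong₂ _,_ (assoc₁ θ u v s t p q) (assoc₂ θ u v s t p q) }
          ; *-identity = ⊗-identityˡ , (λ x → trans (⊗-comm x (1# , 0#)) (⊗-identityˡ x))
          ; distrib = ⊗-distribˡ
                    , (λ x y z → trans (⊗-comm (y ⊕ z) x) (trans (⊗-distribˡ x y z) (cong₂ _⊕_ (⊗-comm x y) (⊗-comm x z)))) }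
        ; *-comm = ⊗-comm }

      sq≡0 : ∀ {x} → x * x ≡ 0# → x ≡ 0#
      sq≡0 eq with integral eq
      ... | inj₁ p = p
      ... | inj₂ p = p

      *-cancelʳ′ : ∀ {x y z} → x * z ≡ y * z → x ≡ y ⊎ z ≡ 0#
      *-cancelʳ′ {x} {y} {z} eq with integral (trans ([y-z]x≈yx-zx z x y) (x≈y⇒x∙y⁻¹≈ε eq))
      ... | inj₁ p = inj₁ (x∙y⁻¹≈ε⇒x≈y _ _ p)
      ... | inj₂ p = inj₂ p

      neg-of : ∀ {x y} → x + y ≡ 0# → x ≡ - y
      neg-of {x} {y} eq = inverseʳ-unique y x (trans (+-comm y x) eq)

      zero-root : ∀ {u v} → u * u ≡ θ * (v * v) → u ≡ 0# × v ≡ 0#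
      zero-root {u} {v} p = sq≡0 (trans p (trans (cong (λ x → θ * (x * x)) v≡0) (trans (cong (θ *_) (zeroˡ 0#)) (zeroʳ θ)))) , v≡0
        where
        v≡0 : v ≡ 0#
        v≡0 = θ-nonsquare p

      zero-component : ∀ {u v z} → (u * u) * z ≡ (θ * (v * v)) * z → (u ≡ 0# × v ≡ 0#) ⊎ z ≡ 0#
      zero-component eq = Sum.map₁ zero-root (*-cancelʳ′ eq)

      -- The hypotheses say (u + v√θ)(s + t√θ) = 0. Multiplying by the conjugate u - v√θ shows that
      -- the norm u² - θv² annihilates both s and t.
      module _ {u v s t : Carrier} (e₁ : u * s + θ * (v * t) ≡ 0#) (e₂ : u * t + v * s ≡ 0#) where
        us : u * s ≡ - (θ * (v * t))
        us = neg-of e₁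
        ut : u * t ≡ - (v * s)
        ut = neg-of e₂

        swap₁ : ∀ a v t u → u * (a * (v * t)) ≡ a * (v * (u * t))
        swap₁ = solve 4 (λ a v t u → (u :* (a :* (v :* t))) := (a :* (v :* (u :* t)))) refl
        reassoc : ∀ a v s → a * (v * (v * s)) ≡ (a * (v * v)) * s
        reassoc = solve 3 (λ a v s → (a :* (v :* (v :* s))) := ((a :* (v :* v)) :* s)) refl
        swap₂ : ∀ v s u → u * (v * s) ≡ v * (u * s)
        swap₂ = solve 3 (λ v s u → (u :* (v :* s)) := (v :* (u :* s))) refl
        swap₃ : ∀ a v t → v * (a * (v * t)) ≡ (a * (v * v)) * t
        swap₃ = solve 3 (λ a v t → (v :* (a :* (v :* t))) := ((a :* (v :* v)) :* t)) refl

        kill-s : (u * u) * s ≡ (θ * (v * v)) * s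
        kill-s = begin
          (u * u) * s              ≡⟨ *-assoc u u s ⟩
          u * (u * s)              ≡⟨ cong (u *_) us ⟩
          u * (- (θ * (v * t)))    ≡⟨ -‿distribʳ-* u _ ⟨
          - (u * (θ * (v * t)))    ≡⟨ cong -_ (swap₁ θ v t u) ⟩
          - (θ * (v * (u * t)))    ≡⟨ cong (λ x → - (θ * (v * x))) ut ⟩
          - (θ * (v * (- (v * s)))) ≡⟨ cong (λ x → - (θ * x)) (-‿distribʳ-* v _) ⟨
          - (θ * (- (v * (v * s)))) ≡⟨ cong -_ (-‿distribʳ-* θ _) ⟨
          - (- (θ * (v * (v * s)))) ≡⟨ -‿involutive _ ⟩
          θ * (v * (v * s))        ≡⟨ reassoc θ v s ⟩
          (θ * (v * v)) * s        ∎

        kill-t : (u * u) * t ≡ (θ * (v * v)) * t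
        kill-t = begin
          (u * u) * t              ≡⟨ *-assoc u u t ⟩
          u * (u * t)              ≡⟨ cong (u *_) ut ⟩
          u * (- (v * s))          ≡⟨ -‿distribʳ-* u _ ⟨
          - (u * (v * s))          ≡⟨ cong -_ (swap₂ v s u) ⟩
          - (v * (u * s))          ≡⟨ cong (λ x → - (v * x)) us ⟩
          - (v * (- (θ * (v * t)))) ≡⟨ cong -_ (-‿distribʳ-* v _) ⟨
          - (- (v * (θ * (v * t)))) ≡⟨ -‿involutive _ ⟩
          v * (θ * (v * t))        ≡⟨ swap₃ θ v t ⟩
          (θ * (v * v)) * t        ∎

      ⊗-integral : ∀ {x y} → x ⊗ y ≡ (0# , 0#) → x ≡ (0# , 0#) ⊎ y ≡ (0# , 0#)
      ⊗-integral {u , v} {s , t} eq = decide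
          (zero-component (kill-s (cong proj₁ eq) (cong proj₂ eq)))
          (zero-component (kill-t (cong proj₁ eq) (cong proj₂ eq)))
        where
        decide : (u ≡ 0# × v ≡ 0#) ⊎ s ≡ 0# → (u ≡ 0# × v ≡ 0#) ⊎ t ≡ 0# → (u , v) ≡ (0# , 0#) ⊎ (s , t) ≡ (0# , 0#)
        decide (inj₁ (p , q)) _              = inj₁ (cong₂ _,_ p q)
        decide (inj₂ _)       (inj₁ (p , q)) = inj₁ (cong₂ _,_ p q)
        decide (inj₂ p)       (inj₂ q)       = inj₂ (cong₂ _,_ p q)

      -- With d = u² - θ v² and e = s² - θ t², the norms of both sides of
      -- (u + v√θ)² = √θ (s + t√θ)² give d² = - θ e².
      module _ {u v s t : Carrier} (e₁ : u * u + θ * (v * v) ≡ θ * (s * t + t * s)) (e₂ : u * v + v * u ≡ s * s + θ * (t * t)) where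
        d e : Carrier
        d = u * u + - (θ * (v * v))
        e = s * s + - (θ * (t * t))

        split : ∀ x y → x ≡ (x + - y) + y
        split x y = sym (trans (+-assoc x (- y) y) (trans (cong (x +_) (-‿inverseˡ y)) (+-identityʳ x)))

        -- This is (p + q)² = (p - q)² + 4pq with p written as d + q, which makes it an identity of
        -- semirings; `square-sum′` puts d = p - q back.
        square-sum : ∀ d q → ((d + q) + q) * ((d + q) + q) ≡ d * d + (((d + q) * q + (d + q) * q) + ((d + q) * q + (d + q) * q))
        square-sum = solve 2 (λ d q → (((d :+ q) :+ q) :* ((d :+ q) :+ q)) := (d :* d :+ (((d :+ q) :* q :+ (d :+ q) :* q) :+ ((d :+ q) :* q :+ (d :+ q) :* q)))) refl

        square-sum′ : ∀ p q → (p + q) * (p + q) ≡ (p + - q) * (p + - q) + ((p * q + p * q) + (p * q + p * q))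
        square-sum′ p q = subst (λ p′ → (p′ + q) * (p′ + q) ≡ (p + - q) * (p + - q) + ((p′ * q + p′ * q) + (p′ * q + p′ * q))) (sym (split p q)) (square-sum (p + - q) q)

        shuffle₁ : ∀ a u v → ((u * u) * (a * (v * v)) + (u * u) * (a * (v * v))) + ((u * u) * (a * (v * v)) + (u * u) * (a * (v * v)))
                           ≡ a * ((u * v + v * u) * (u * v + v * u))
        shuffle₁ = solve 3 (λ a u v → (((u :* u) :* (a :* (v :* v)) :+ (u :* u) :* (a :* (v :* v))) :+ ((u :* u) :* (a :* (v :* v)) :+ (u :* u) :* (a :* (v :* v)))) := (a :* ((u :* v :+ v :* u) :* (u :* v :+ v :* u)))) refl
        shuffle₂ : ∀ a s t x → a * (x + (((s * s) * (a * (t * t)) + (s * s) * (a * (t * t))) + ((s * s) * (a * (t * t)) + (s * s) * (a * (t * t)))))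
                           ≡ a * x + (a * (s * t + t * s)) * (a * (s * t + t * s))
        shuffle₂ = solve 4 (λ a s t x → (a :* (x :+ (((s :* s) :* (a :* (t :* t)) :+ (s :* s) :* (a :* (t :* t))) :+ ((s :* s) :* (a :* (t :* t)) :+ (s :* s) :* (a :* (t :* t)))))) := (a :* x :+ (a :* (s :* t :+ t :* s)) :* (a :* (s :* t :+ t :* s)))) refl

        norms : d * d + θ * (e * e) ≡ 0#
        -- `M` is the square of the right side of `e₁`. Adding it completes e² to (s² + θt²)², which
        -- is (2uv)² by `e₂`, and this in turn completes d² to (u² + θv²)².
        norms = +-cancelʳ M _ _ (begin
          (d * d + θ * (e * e)) + M                ≡⟨ +-assoc (d * d) (θ * (e * e)) M ⟩
          d * d + (θ * (e * e) + M)                ≡⟨ cong (d * d +_) (shuffle₂ θ s t (e * e)) ⟨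
          d * d + θ * (e * e + _)                  ≡⟨ cong (λ x → d * d + θ * x) (square-sum′ (s * s) (θ * (t * t))) ⟨
          d * d + θ * ((s * s + θ * (t * t)) * (s * s + θ * (t * t))) ≡⟨ cong (λ x → d * d + θ * (x * x)) e₂ ⟨
          d * d + θ * ((u * v + v * u) * (u * v + v * u)) ≡⟨ cong (d * d +_) (shuffle₁ θ u v) ⟨
          d * d + _                                ≡⟨ square-sum′ (u * u) (θ * (v * v)) ⟨
          (u * u + θ * (v * v)) * (u * u + θ * (v * v)) ≡⟨ cong (λ x → x * x) e₁ ⟩
          M                                        ≡⟨ +-identityˡ M ⟨
          0# + M                                   ∎)
          where
          M : Carrier
          M = (θ * (s * t + t * s)) * (θ * (s * t + t * s))

        regroup : ∀ i d → (i * d) * (i * d) ≡ (i * i) * (d * d)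
        regroup = solve 2 (λ i d → ((i :* d) :* (i :* d)) := ((i :* i) :* (d :* d))) refl

        e≡0 : e ≡ 0#
        -- Since ι² = -1, the relation d² = -θe² exhibits θe² as the square of ιd.
        e≡0 = θ-nonsquare {ι * d} (begin
          (ι * d) * (ι * d)        ≡⟨ regroup ι d ⟩
          (ι * ι) * (d * d)        ≡⟨ cong (_* (d * d)) ι²≡-1 ⟩
          (- 1#) * (d * d)         ≡⟨ -1*x≈-x (d * d) ⟩
          - (d * d)                ≡⟨ cong -_ (neg-of norms) ⟩
          - (- (θ * (e * e)))      ≡⟨ -‿involutive _ ⟩
          θ * (e * e)              ∎)

        ss : s * s ≡ θ * (t * t)
        ss = x∙y⁻¹≈ε⇒x≈y _ _ e≡0

        st≡0 : (s , t) ≡ (0# , 0#)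
        st≡0 = cong₂ _,_ (proj₁ (zero-root ss)) (proj₂ (zero-root ss))

      √θ-nonsquare : ∀ {x y} → x ⊗ x ≡ (0# , 1#) ⊗ (y ⊗ y) → y ≡ (0# , 0#)
      √θ-nonsquare {u , v} {s , t} eq = st≡0 {u} {v} (trans (cong proj₁ eq) (fst θ s t)) (trans (cong proj₂ eq) (snd θ s t))
        where
        fst : ∀ a s t → 0# * (s * s + a * (t * t)) + a * (1# * (s * t + t * s)) ≡ a * (s * t + t * s)
        fst = solve 3 (λ a s t → (con 0 :* (s :* s :+ a :* (t :* t)) :+ a :* (con 1 :* (s :* t :+ t :* s))) := (a :* (s :* t :+ t :* s))) refl
        snd : ∀ a s t → 0# * (s * t + t * s) + 1# * (s * s + a * (t * t)) ≡ s * s + a * (t * t)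
        snd = solve 3 (λ a s t → (con 0 :* (s :* t :+ t :* s) :+ con 1 :* (s :* s :+ a :* (t :* t))) := (s :* s :+ a :* (t :* t))) refl

      ι-square : (ι , 0#) ⊗ (ι , 0#) ≡ ⊖ (1# , 0#)
      ι-square = cong₂ _,_ (trans (i₁ θ ι) ι²≡-1) (trans (i₂ ι) (sym -0#≈0#))
        where
        i₁ : ∀ a i → i * i + a * (0# * 0#) ≡ i * i
        i₁ = solve 2 (λ a i → (i :* i :+ a :* (con 0 :* con 0)) := (i :* i)) refl
        i₂ : ∀ i → i * 0# + 0# * i ≡ 0#
        i₂ = solve 1 (λ i → (i :* con 0 :+ con 0 :* i) := (con 0)) refl

    quadratic : Domain
    quadratic = record
      { Carrier = K ; _+_ = _⊕_ ; _*_ = _⊗_ ; -_ = ⊖_ ; 0# = 0# , 0# ; 1# = 1# , 0#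
      ; isCommutativeRing = isCR
      ; _≟_ = ×ₚ.≡-dec _≟_ _≟_
      ; integral = ⊗-integral
      ; ι = ι , 0# ; ι²≡-1 = ι-square
      ; θ = 0# , 1# ; θ-nonsquare = λ {x} {y} → √θ-nonsquare {x} {y}
      ; dim = dim ℕ.+ dim
      ; point = λ v → point (Vec.take dim v) , point (Vec.drop dim v)
      ; point-injective = λ {v} {w} eq → trans (sym (Vecₚ.take++drop≡id dim v)) (trans
          (cong₂ Vec._++_ (point-injective (cong proj₁ eq)) (point-injective (cong proj₂ eq)))
          (Vecₚ.take++drop≡id dim w))
      ; code = subst (Code trivial) (sym (ℕₚ.*-distribˡ-+ 3 dim dim)) (retractC (λ x → x) just (λ _ → _ , refl) (code ×C code))
      }

  -- An extension is taken only when the required dimension has just outgrown the present one. At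
  -- that moment the dimension is `suc m`, so doubling it keeps the upper bound.
  domain-of-dim : ∀ m → Σ Domain λ D → suc m ℕ.≤ Domain.dim D × Domain.dim D ℕ.≤ 2 ℕ.* suc m
  domain-of-dim zero = 𝔽₅ , s≤s z≤n , s≤s z≤n
  domain-of-dim (suc m) with domain-of-dim m
  ... | D , lo , hi with suc m ℕ.<? Domain.dim D
  ...   | yes lt = D , lt , ℕₚ.≤-trans hi (ℕₚ.*-monoʳ-≤ 2 (ℕₚ.n≤1+n (suc m)))
  ...   | no ¬lt = quadratic D , grow , shrink
    where
    open ℕₚ.≤-Reasoning
    dim≡ : Domain.dim D ≡ suc m
    dim≡ = ℕₚ.≤-antisym (ℕₚ.≮⇒≥ ¬lt) lo
    grow : suc (suc m) ℕ.≤ Domain.dim D ℕ.+ Domain.dim D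
    grow = begin
      suc (suc m)                    ≤⟨ ℕₚ.+-monoʳ-≤ 1 (ℕₚ.m≤n+m (suc m) m) ⟩
      suc m ℕ.+ suc m                ≡⟨ cong (λ x → x ℕ.+ x) dim≡ ⟨
      Domain.dim D ℕ.+ Domain.dim D  ∎
    shrink : Domain.dim D ℕ.+ Domain.dim D ℕ.≤ 2 ℕ.* suc (suc m)
    shrink = begin
      Domain.dim D ℕ.+ Domain.dim D  ≡⟨ cong (λ x → x ℕ.+ x) dim≡ ⟩
      suc m ℕ.+ suc m                ≡⟨ cong (suc m ℕ.+_) (ℕₚ.+-identityʳ (suc m)) ⟨
      2 ℕ.* suc m                    ≤⟨ ℕₚ.*-monoʳ-≤ 2 (ℕₚ.n≤1+n (suc m)) ⟩
      2 ℕ.* suc (suc m)              ∎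

  -- Polynomials over an integral domain and the number of their roots.

  module RootBound (D : Domain) where
    open Domain D
    open ≡-Reasoning
    open RingSolver commutativeSemiring using (solve; _:=_; _:+_; _:*_; con)

    eval : List Carrier → Carrier → Carrier
    eval []       x = 0#
    eval (c ∷ cs) x = c + x * eval cs x

    -- Synthetic division by X - r, with coefficients listed from the constant term upwards.
    quotient : Carrier → List Carrier → List Carrier
    quotient r []            = []
    quotient r (c ∷ [])      = []
    quotient r (c ∷ c′ ∷ cs) = eval (c′ ∷ cs) r ∷ quotient r (c′ ∷ cs)

    -- The identity f(x) - f(r) = (x - r) q(x), with the negative terms moved to the other side.
    quotient-eval : ∀ r x cs → eval cs x + r * eval (quotient r cs) x ≡ eval cs r + x * eval (quotient r cs) x
    quotient-eval r x [] = trans (cong (0# +_) (zeroʳ r)) (cong (0# +_) (sym (zeroʳ x)))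
    quotient-eval r x (c ∷ []) = lem c r x
      where
      lem : ∀ c r x → (c + x * 0#) + r * 0# ≡ (c + r * 0#) + x * 0#
      lem = solve 3 (λ c r x → ((c :+ x :* con 0) :+ r :* con 0) := ((c :+ r :* con 0) :+ x :* con 0)) refl
    quotient-eval r x (c ∷ cs@(_ ∷ _)) = begin
      (c + x * eval cs x) + r * (eval cs r + x * q)  ≡⟨ lem₁ c x (eval cs x) r (eval cs r) q ⟩
      (c + r * eval cs r) + x * (eval cs x + r * q)  ≡⟨ cong (λ y → (c + r * eval cs r) + x * y) (quotient-eval r x cs) ⟩
      (c + r * eval cs r) + x * (eval cs r + x * q)  ∎
      where
      q : Carrier
      q = eval (quotient r cs) x
      lem₁ : ∀ c x p r p′ q → (c + x * p) + r * (p′ + x * q) ≡ (c + r * p′) + x * (p + r * q)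
      lem₁ = solve 6 (λ c x p r p′ q → ((c :+ x :* p) :+ r :* (p′ :+ x :* q)) := ((c :+ r :* p′) :+ x :* (p :+ r :* q))) refl

    quotient-root : ∀ r x cs → r ≢ x → eval cs r ≡ 0# → eval cs x ≡ 0# → eval (quotient r cs) x ≡ 0#
    quotient-root r x cs r≢x er ex with integral ([y-z]x≈yx-zx q r x ⟨ trans ⟩ x≈y⇒x∙y⁻¹≈ε rq≡xq)
      where
      open import Function using (_⟨_⟩_)
      q : Carrier
      q = eval (quotient r cs) x
      rq≡xq : r * q ≡ x * q
      rq≡xq = begin
        r * q             ≡⟨ +-identityˡ _ ⟨
        0# + r * q        ≡⟨ cong (_+ r * q) ex ⟨
        eval cs x + r * q ≡⟨ quotient-eval r x cs ⟩
        eval cs r + x * q ≡⟨ cong (_+ x * q) er ⟩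
        0# + x * q        ≡⟨ +-identityˡ _ ⟩
        x * q             ∎
    ... | inj₁ p = contradiction (x∙y⁻¹≈ε⇒x≈y _ _ p) r≢x
    ... | inj₂ p = p

    constant-term : ∀ {c e r} → c + r * e ≡ 0# → e ≡ 0# → c ≡ 0#
    constant-term {c} {e} {r} eq e0 = trans (sym (+-identityʳ c)) (trans (cong (c +_) (sym (zeroʳ r))) (trans (cong (λ y → c + r * y) (sym e0)) eq))

    -- A polynomial with zero quotient is constant, and its value at the root `r` is zero.
    quotient-zero : ∀ r cs → eval cs r ≡ 0# → All (_≡ 0#) (quotient r cs) → All (_≡ 0#) cs
    quotient-zero r [] _ _ = []
    quotient-zero r (c ∷ []) er _ = constant-term er refl ∷ []
    quotient-zero r (c ∷ cs@(_ ∷ _)) er (z ∷ zs) = constant-term er z ∷ quotient-zero r cs z zs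

    length-quotient : ∀ r c cs → length (quotient r (c ∷ cs)) ≡ length cs
    length-quotient r c [] = refl
    length-quotient r c (c′ ∷ cs) = cong suc (length-quotient r c′ cs)

    -- Dividing by X - r uses up one root and one coefficient; the other roots, being different from
    -- r, remain roots of the quotient.
    all-zero : ∀ rs cs → Unique rs → All (λ r → eval cs r ≡ 0#) rs → length cs ℕ.≤ length rs → All (_≡ 0#) cs
    all-zero rs [] _ _ _ = []
    all-zero (r ∷ rs) cs@(c ∷ cs′) (r∉ ∷ uniq) (er ∷ ers) (s≤s le) = quotient-zero r cs er
      (all-zero rs (quotient r cs) uniq
        (All.map (λ { {x} (r≢x , ex) → quotient-root r x cs r≢x er ex }) (All.zip (r∉ , ers)))
        (subst (ℕ._≤ length rs) (sym (length-quotient r c cs′)) le))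

  -- Words and their polynomial fingerprints.

  record Hash (T : ℕ) : Set₁ where
    infixl 7 _·_
    field
      Carrier : Set
      ε       : Carrier
      _·_     : Carrier → Carrier → Carrier
      letter  : Fin T → Carrier

    hash : List (Fin T) → Carrier
    hash []      = ε
    hash (a ∷ x) = letter a · hash x

  -- This instance serves the proofs only: a machine run over it displays the words whose
  -- fingerprints the algorithm holds.
  free : (T : ℕ) → Hash T
  free T = record { Carrier = List (Fin T) ; ε = [] ; _·_ = _++_ ; letter = λ a → a ∷ [] }

  -- Words are hashed to affine maps y ↦ h + p y, where h is the value at r of
  -- the polynomial whose coefficients are the letters and p = r ^ length.
  module AffineHash {T : ℕ} (D : Domain) (embed : Fin T → Domain.Carrier D)
    (embed-injective : ∀ {a a′} → embed a ≡ embed a′ → a ≡ a′) where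
    open Domain D
    open RootBound D

    affine : Carrier → Hash T
    affine r = record
      { Carrier = Carrier × Carrier
      ; ε       = 0# , 1#
      ; _·_     = λ { (h , p) (h′ , p′) → h + p * h′ , p * p′ }
      ; letter  = λ a → embed a , r
      }

    hash : Carrier → List (Fin T) → Carrier × Carrier
    hash r = Hash.hash (affine r)

    hash-letter : ∀ r a → hash r (a ∷ []) ≡ (embed a , r)
    hash-letter r a = cong₂ _,_ (trans (cong (embed a +_) (zeroʳ r)) (+-identityʳ _)) (*-identityʳ r)

    hash-++ : ∀ r x y → hash r (x ++ y) ≡ Hash._·_ (affine r) (hash r x) (hash r y)
    hash-++ r [] y = cong₂ _,_ (sym (trans (+-identityˡ _) (*-identityˡ _))) (sym (*-identityˡ _))
    hash-++ r (a ∷ x) y rewrite hash-++ r x y = cong₂ _,_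
      (trans (cong (embed a +_) (trans (distribˡ r _ _) (cong (r * proj₁ (hash r x) +_) (sym (*-assoc r _ _))))) (sym (+-assoc (embed a) _ _)))
      (sym (*-assoc r _ _))

    hash-eval : ∀ r x → proj₁ (hash r x) ≡ eval (map embed x) r
    hash-eval r [] = refl
    hash-eval r (a ∷ x) = cong (λ y → embed a + r * y) (hash-eval r x)

    differences : List (Fin T) → List (Fin T) → List Carrier
    differences = zipWith (λ a a′ → embed a + - embed a′)

    eval-differences : ∀ r x y → length x ≡ length y → eval (differences x y) r + eval (map embed y) r ≡ eval (map embed x) r
    eval-differences r [] [] eq = +-identityˡ 0#
    eval-differences r (a ∷ x) (a′ ∷ y) eq = begin
      ((embed a + - embed a′) + r * d) + (embed a′ + r * q)   ≡⟨ +-assoc (embed a + - embed a′) _ _ ⟩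
      (embed a + - embed a′) + (r * d + (embed a′ + r * q))   ≡⟨ cong ((embed a + - embed a′) +_) (swap (r * d) (embed a′) (r * q)) ⟩
      (embed a + - embed a′) + (embed a′ + (r * d + r * q))   ≡⟨ +-assoc _ (embed a′) _ ⟨
      ((embed a + - embed a′) + embed a′) + (r * d + r * q)   ≡⟨ cong₂ _+_ cancel (sym (distribˡ r d q)) ⟩
      embed a + r * (d + q)                                   ≡⟨ cong (λ z → embed a + r * z) (eval-differences r x y (ℕₚ.suc-injective eq)) ⟩
      embed a + r * eval (map embed x) r                      ∎
      where
      open ≡-Reasoning
      d = eval (differences x y) r
      q = eval (map embed y) r
      swap : ∀ u v w → u + (v + w) ≡ v + (u + w)
      swap u v w = trans (sym (+-assoc u v w)) (trans (cong (_+ w) (+-comm u v)) (+-assoc v u w))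
      cancel : (embed a + - embed a′) + embed a′ ≡ embed a
      cancel = trans (+-assoc _ _ _) (trans (cong (embed a +_) (-‿inverseˡ _)) (+-identityʳ _))

    collision-root : ∀ r x y → length x ≡ length y → hash r x ≡ hash r y → eval (differences x y) r ≡ 0#
    collision-root r x y len eq = +-cancelʳ _ _ _ (trans (eval-differences r x y len)
      (trans (sym (hash-eval r x)) (trans (cong proj₁ eq) (trans (hash-eval r y) (sym (+-identityˡ _))))))

    differences-zero : ∀ x y → length x ≡ length y → All (_≡ 0#) (differences x y) → x ≡ y
    differences-zero [] [] _ _ = refl
    differences-zero (a ∷ x) (a′ ∷ y) eq (z ∷ zs) =
      cong₂ _∷_ (embed-injective (x∙y⁻¹≈ε⇒x≈y _ _ z)) (differences-zero x y (ℕₚ.suc-injective eq) zs)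

    length-differences : ∀ x y → length x ≡ length y → length (differences x y) ≡ length x
    length-differences [] [] eq = refl
    length-differences (a ∷ x) (a′ ∷ y) eq = cong ℕ.suc (length-differences x y (ℕₚ.suc-injective eq))

    -- Every collision is a root of the polynomial of letter differences. As `embed` is injective,
    -- that polynomial is nonzero for distinct words, and it has as many coefficients as `x` has
    -- letters.
    few-collisions : ∀ rs → Unique rs → ∀ x y → length x ≡ length y → All (λ r → hash r x ≡ hash r y) rs → x ≢ y →
                     length rs ℕ.< length x
    few-collisions rs uniq x y len hits x≢y with length rs ℕ.<? length x
    ... | yes lt = lt
    ... | no ¬lt = contradiction (differences-zero x y len (all-zero rs (differences x y) uniq
            (All.map (collision-root _ x y len) hits)
            (ℕₚ.≤-trans (ℕₚ.≤-reflexive (length-differences x y len)) (ℕₚ.≮⇒≥ ¬lt)))) x≢y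

open Domains

open import Data.Nat
open import Data.Nat.Properties
open import Data.List using (_++_; take; map; concatMap; filter; cartesianProductWith)
open import Data.List.Properties using (++-assoc; ++-identityʳ; map-++; map-∘; length-++; length-map)

does-true : {A : Set} (a? : Dec A) → does a? ≡ true → A
does-true (yes a) _ = a

-- Derivation forests, and emptiness of a grammar intersected with an automaton.

module _ {T : ℕ} (G : Grammar T) where
  open Grammar G

  -- Derivation forests of height at most `h`: the children of an expanded nonterminal lose one
  -- level, its right siblings keep the full height. Heights thus match the stages of the table
  -- below.
  data Yields : ℕ → SF G → List (Fin T) → Set where
    []   : ∀ {h} → Yields h [] []
    term : ∀ {h a γ x} → Yields h γ x → Yields h (inj₂ a ∷ γ) (a ∷ x)
    prod : ∀ {h A α γ x y} → (A , α) ∈ P → Yields h α x → Yields (suc h) γ y →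
           Yields (suc h) (inj₁ A ∷ γ) (x ++ y)

  Yields-suc : ∀ {h γ x} → Yields h γ x → Yields (suc h) γ x
  Yields-suc [] = []
  Yields-suc (term d) = term (Yields-suc d)
  Yields-suc (prod p d e) = prod p (Yields-suc d) (Yields-suc e)

  Yields-split : ∀ {h} α {β x} → Yields h (α ++ β) x →
                 ∃[ y ] ∃[ z ] x ≡ y ++ z × Yields h α y × Yields h β z
  Yields-split [] d = [] , _ , refl , [] , d
  Yields-split (inj₂ a ∷ α) (term d) with Yields-split α d
  ... | y , z , refl , dα , dβ = a ∷ y , z , refl , term dα , dβ
  Yields-split (inj₁ A ∷ α) (prod {x = x} p d e) with Yields-split α e
  ... | y , z , refl , dα , dβ = x ++ y , z , sym (++-assoc x y z) , prod p d dα , dβ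

  step-context : ∀ ξ {γ δ} ζ → Step G γ δ → Step G (ξ ++ γ ++ ζ) (ξ ++ δ ++ ζ)
  step-context ξ ζ (derivStep x A α y p) =
    subst₂ (Step G) (shape (inj₁ A ∷ [])) (shape α)
      (derivStep (ξ ++ x) A α (y ++ ζ) p)
    where
    open ≡-Reasoning
    shape : ∀ α → (ξ ++ x) ++ α ++ y ++ ζ ≡ ξ ++ (x ++ α ++ y) ++ ζ
    shape α = begin
      (ξ ++ x) ++ α ++ y ++ ζ   ≡⟨ ++-assoc ξ x _ ⟩
      ξ ++ x ++ α ++ y ++ ζ     ≡⟨ cong (λ t → ξ ++ x ++ t) (++-assoc α y ζ) ⟨
      ξ ++ x ++ (α ++ y) ++ ζ   ≡⟨ cong (ξ ++_) (++-assoc x (α ++ y) ζ) ⟨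
      ξ ++ (x ++ α ++ y) ++ ζ   ∎

  derives-context : ∀ ξ {γ δ} ζ → Derives G γ δ → Derives G (ξ ++ γ ++ ζ) (ξ ++ δ ++ ζ)
  derives-context ξ ζ Star.ε = Star.ε
  derives-context ξ ζ (s ◅ d) = step-context ξ ζ s ◅ derives-context ξ ζ d

  Yields⇒Derives : ∀ {h γ x} → Yields h γ x → Derives G γ (terminals G x)
  Yields⇒Derives [] = Star.ε
  Yields⇒Derives (term {a = a} {γ} {x} d) =
    subst₂ (Derives G) (cong (inj₂ a ∷_) (++-identityʳ γ)) (cong (inj₂ a ∷_) (++-identityʳ _))
      (derives-context (inj₂ a ∷ []) [] (Yields⇒Derives d))
  Yields⇒Derives (prod {A = A} {α} {γ} {x} {y} p d e) =
    derivStep [] A α γ p ◅ derives-context [] γ (Yields⇒Derives d) ◅◅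
    subst₂ (Derives G) (cong (terminals G x ++_) (++-identityʳ γ))
      (trans (cong (terminals G x ++_) (++-identityʳ _)) (sym (map-++ inj₂ x y)))
      (derives-context (terminals G x) [] (Yields⇒Derives e))

  -- Stage h of the table accounts for the derivations of height at most h.
  -- There are finitely many tables, so by orbit-hit a bounded number of stages
  -- suffices to decide whether some derivation has a word the automaton reads.
  module Automaton {q : ℕ} (δ : Fin q → Fin T → Maybe (Fin q)) where

    walk : Fin q → List (Fin T) → Maybe (Fin q)
    walk i []      = just i
    walk i (a ∷ x) = δ i a >>= λ i′ → walk i′ x

    Table : Set
    Table = Vec Bool (nN * (q * q))

    entry : Table → Fin nN → Fin q → Fin q → Bool
    entry t A i j = lookup t (combine A (combine i j))

    -- A true entry stands for a nonterminal deriving some word that leads from `i` to `j`. Along a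
    -- sentential form these moves are chained with the automaton's own moves on terminals.
    Connects : Table → SF G → Fin q → Fin q → Set
    Connects t []           i j = i ≡ j
    Connects t (inj₁ A ∷ γ) i j = ∃[ i′ ] entry t A i i′ ≡ true × Connects t γ i′ j
    Connects t (inj₂ a ∷ γ) i j = ∃[ i′ ] δ i a ≡ just i′ × Connects t γ i′ j

    connects? : ∀ t γ i j → Dec (Connects t γ i j)
    connects? t []           i j = i Finₚ.≟ j
    connects? t (inj₁ A ∷ γ) i j = Finₚ.any? λ i′ → (entry t A i i′ Boolₚ.≟ true) ×-dec connects? t γ i′ j
    connects? t (inj₂ a ∷ γ) i j with δ i a
    ... | nothing = no λ ()
    ... | just i′ = map′ (λ c → i′ , refl , c) (λ { (_ , refl , c) → c }) (connects? t γ i′ j)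

    Expands : Table → Fin nN → Fin q → Fin q → Set
    Expands t A i j = Any (λ p → proj₁ p ≡ A × Connects t (proj₂ p) i j) P

    expands? : ∀ t A i j → Dec (Expands t A i j)
    expands? t A i j = any? (λ p → (proj₁ p Finₚ.≟ A) ×-dec connects? t (proj₂ p) i j) P

    cell : Table → Fin nN → Fin q × Fin q → Bool
    cell t A (i , j) = does (expands? t A i j)

    next : Table → Table
    next t = tabulate λ idx → cell t (proj₁ (remQuot {nN} (q * q) idx)) (remQuot {q} q (proj₂ (remQuot {nN} (q * q) idx)))

    initial : Table
    initial = Vec.replicate _ false

    table : ℕ → Table
    table = fold initial next

    entry-next : ∀ t A i j → entry (next t) A i j ≡ does (expands? t A i j)
    entry-next t A i j = trans (Vecₚ.lookup∘tabulate _ (combine A (combine i j))) (trans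
      (cong (λ p → cell t (proj₁ p) (remQuot {q} q (proj₂ p))) (Finₚ.remQuot-combine A (combine i j)))
      (cong (cell t A) (Finₚ.remQuot-combine i j)))

    walk-++ : ∀ x y {i i′} → walk i x ≡ just i′ → walk i (x ++ y) ≡ walk i′ y
    walk-++ [] y refl = refl
    walk-++ (a ∷ x) y {i} eq with δ i a
    ... | just i₁ = walk-++ x y eq

    walk-prefix : ∀ x y {i j} → walk i (x ++ y) ≡ just j → ∃[ i′ ] walk i x ≡ just i′ × walk i′ y ≡ just j
    walk-prefix [] y {i} eq = i , refl , eq
    walk-prefix (a ∷ x) y {i} eq with δ i a
    ... | just i₁ = walk-prefix x y eq

    yields⇒connects : ∀ h γ {x i j} → Yields h γ x → walk i x ≡ just j → Connects (table h) γ i j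
    yields⇒connects h [] [] refl = refl
    yields⇒connects h (inj₂ a ∷ γ) {i = i} (term d) eq with δ i a
    ... | just i′ = i′ , refl , yields⇒connects h γ d eq
    yields⇒connects (suc h) (inj₁ A ∷ γ) {i = i} (prod {α = α} {x = x} {y} p d e) eq with walk-prefix x y eq
    ... | i′ , ex , ey = i′
        , trans (entry-next (table h) A i i′) (dec-true (expands? (table h) A i i′) (lose p (refl , yields⇒connects h α d ex)))
        , yields⇒connects (suc h) γ e ey

    connects⇒yields : ∀ h γ {i j} → Connects (table h) γ i j → ∃[ x ] Yields h γ x × walk i x ≡ just j
    connects⇒yields h [] refl = [] , [] , refl
    connects⇒yields h (inj₂ a ∷ γ) {i} (i′ , eq , c) with connects⇒yields h γ c
    ... | x , d , ex = a ∷ x , term d , trans (cong (_>>= λ i′ → walk i′ x) eq) ex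
    connects⇒yields zero (inj₁ A ∷ γ) {i} (i′ , eq , c) =
      contradiction (trans (sym eq) (Vecₚ.lookup-replicate (combine A (combine i i′)) false)) λ ()
    connects⇒yields (suc h) (inj₁ A ∷ γ) {i} (i′ , eq , c)
      with find (does-true (expands? (table h) A i i′) (trans (sym (entry-next (table h) A i i′)) eq))
         | connects⇒yields (suc h) γ c
    ... | (_ , α) , p , refl , cα | y , e , ey with connects⇒yields h α cα
    ...   | x , d , ex = x ++ y , prod p d e , trans (walk-++ x y ex) ey

    Reaches : SF G → Fin q → Set
    Reaches γ i = ∃[ x ] ∃[ h ] Yields h γ x × ∃[ j ] walk i x ≡ just j

    reaches? : ∀ γ i → Dec (Reaches γ i)
    reaches? γ i = map′ to from
      (Finₚ.any? λ (h : Fin (2 ^ (nN * (q * q)))) → Finₚ.any? λ j → connects? (table (Fin.toℕ h)) γ i j)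
      where
      to : ∃[ h ] ∃[ j ] Connects (table (Fin.toℕ h)) γ i j → Reaches γ i
      to (h , j , c) with connects⇒yields (Fin.toℕ h) γ c
      ... | x , d , ex = x , Fin.toℕ h , d , j , ex
      from : Reaches γ i → ∃[ h ] ∃[ j ] Connects (table (Fin.toℕ h)) γ i j
      from (x , h , d , j , ex)
        with h′ , h′< , j′ , c ← orbit-hit (bitsC _) next initial (λ _ → tt) (λ t → ∃[ j ] Connects t γ i j) h
                                  (j , yields⇒connects h γ d ex)
        = Fin.fromℕ< h′< , j′ , subst (λ n → Connects (table n) γ i j′) (sym (Finₚ.toℕ-fromℕ< h′<)) c

  -- Lookahead windows and the choice of a production.

  -- The automaton reading a window u of the input; words may leave the window
  -- only if it is open, i.e. not cut short by the end of the input.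
  window : Bool → (u : List (Fin T)) → Fin (suc (length u)) → Fin T → Maybe (Fin (suc (length u)))
  window open? []      zero    a = if open? then just zero else nothing
  window open? (c ∷ u) zero    a = if does (c Finₚ.≟ a) then just (suc zero) else nothing
  window open? (c ∷ u) (suc i) a = Maybe.map suc (window open? u i a)

  open Automaton using (walk)

  outlives-open : ∀ open? a x {j} → walk (window open? []) zero (a ∷ x) ≡ just j → open? ≡ true
  outlives-open true _ _ _ = refl

  module _ (open? : Bool) where

    walk-suc : ∀ c u i x → walk (window open? (c ∷ u)) (suc i) x ≡ Maybe.map suc (walk (window open? u) i x)
    walk-suc c u i [] = refl
    walk-suc c u i (a ∷ x) with window open? u i a
    ... | nothing = refl
    ... | just i′ = walk-suc c u i′ x

    -- The word `v` becomes the continuation demanded by `Select`: it fills the window when `x` ends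
    -- inside it, and is empty when `x` runs beyond an open window.
    walk-end : ∀ u {x j} → walk (window open? u) zero x ≡ just j →
               ∃[ v ] ((x ++ v ≡ u) ⊎ (open? ≡ true × take (length u) (x ++ v) ≡ u))
    walk-end u {[]} eq = u , inj₁ refl
    walk-end [] {a ∷ x} eq = [] , inj₂ (outlives-open open? a x eq , refl)
    walk-end (c ∷ u) {a ∷ x} eq with c Finₚ.≟ a
    ... | yes refl with walk (window open? u) zero x in eq′ | walk-suc c u zero x
    ...   | nothing | e = contradiction (trans (sym e) eq) λ ()
    ...   | just j′ | _ with walk-end u {x} eq′
    ...     | v , inj₁ p = v , inj₁ (cong (c ∷_) p)
    ...     | v , inj₂ (o , p) = v , inj₂ (o , cong (c ∷_) p)

    walk-prefix-of : ∀ x v → ∃[ j ] walk (window open? (x ++ v)) zero x ≡ just j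
    walk-prefix-of [] v = zero , refl
    walk-prefix-of (a ∷ x) v with a Finₚ.≟ a
    ... | no ne = contradiction refl ne
    ... | yes _ with walk-prefix-of x v
    ...   | j , eq = suc j , trans (walk-suc a (x ++ v) zero x) (cong (Maybe.map suc) eq)

  walk-open : ∀ n x v → n ≤ length (x ++ v) → ∃[ j ] Automaton.walk (window true (take n (x ++ v))) zero x ≡ just j
  walk-open n [] v le = zero , refl
  walk-open zero (a ∷ x) v le = walk-open zero x v z≤n
  walk-open (suc n) (a ∷ x) v (s≤s le) with a Finₚ.≟ a
  ... | no ne = contradiction refl ne
  ... | yes _ with walk-open n x v le
  ...   | j , eq = suc j , trans (walk-suc true a (take n (x ++ v)) zero x) (cong (Maybe.map suc) eq)

  -- In `Select` the continuation after α is arbitrary, so only the words of α matter: they have to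
  -- agree with the lookahead as far as both reach. A lookahead shorter than `k` ends with the
  -- input, and words may not run past it.
  Viable : ℕ → SF G → List (Fin T) → Set
  Viable k α u = Automaton.Reaches (window (k ≤ᵇ length u) u) α zero

  viable? : ∀ k α u → Dec (Viable k α u)
  viable? k α u = Automaton.reaches? (window (k ≤ᵇ length u) u) α zero

  Viable⇒Select : ∀ k α u → length u ≤ k → Viable k α u → Select G k α u
  Viable⇒Select k α u le (x , h , d , j , ex) with walk-end (k ≤ᵇ length u) u {x} ex
  ... | v , r = v , x ++ v
      , subst (λ t → Derives G (α ++ terminals G v) t) (sym (map-++ inj₂ x v)) (derives-context [] (terminals G v) (Yields⇒Derives d))
      , prefix r
    where
    prefix : (x ++ v ≡ u) ⊎ ((k ≤ᵇ length u) ≡ true × take (length u) (x ++ v) ≡ u) → take k (x ++ v) ≡ u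
    prefix (inj₁ eq) = trans (cong (take k) eq) (Listₚ.take-all k u le)
    -- An open window has at least `k` symbols, hence exactly `k`.
    prefix (inj₂ (o , eq)) = subst (λ l → take l (x ++ v) ≡ u) (≤-antisym le (≤ᵇ⇒≤ k (length u) (Equivalence.from Boolₚ.T-≡ o))) eq

  Yields⇒Viable : ∀ k {h α x} v → Yields h α x → Viable k α (take k (x ++ v))
  Yields⇒Viable k {h} {α} {x} v d with k ≤? length (x ++ v)
  ... | yes le = subst (λ o → Automaton.Reaches (window o (take k (x ++ v))) α zero) (sym full) (x , h , d , walk-open k x v le)
    where
    full : (k ≤ᵇ length (take k (x ++ v))) ≡ true
    full = Equivalence.to Boolₚ.T-≡ (≤⇒≤ᵇ (≤-reflexive (sym (trans (Listₚ.length-take k (x ++ v)) (m≤n⇒m⊓n≡m le)))))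
  ... | no ¬le rewrite Listₚ.take-all k (x ++ v) (≰⇒≥ ¬le) = x , h , d , walk-prefix-of _ x v

  choose : ℕ → Fin nN → List (Fin T) → Maybe (SF G)
  choose k A u with any? (λ p → (proj₁ p Finₚ.≟ A) ×-dec viable? k (proj₂ p) u) P
  ... | yes some = just (proj₂ (proj₁ (find some)))
  ... | no _     = nothing

  choose-∈ : ∀ k A u {α} → choose k A u ≡ just α → (A , α) ∈ P
  choose-∈ k A u eq with any? (λ p → (proj₁ p Finₚ.≟ A) ×-dec viable? k (proj₂ p) u) P
  choose-∈ k A u refl | yes some with find some
  ... | (_ , α) , p , refl , _ = p

  _≟SF_ : (α β : SF G) → Dec (α ≡ β)
  _≟SF_ = Listₚ.≡-dec (⊎ₚ.≡-dec Finₚ._≟_ Finₚ._≟_)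

  -- Both the production found by the search and the one actually used are viable, so the lookahead
  -- lies in both select sets. The LL(k) condition makes them equal.
  choose-complete : ∀ {k} → IsLL G k → ∀ {h A α x} v → (A , α) ∈ P → Yields h α x → choose k A (take k (x ++ v)) ≡ just α
  choose-complete {k} ll {h} {A} {α} {x} v p d
    with any? (λ p → (proj₁ p Finₚ.≟ A) ×-dec viable? k (proj₂ p) (take k (x ++ v))) P
  ... | no none = contradiction (lose p (refl , Yields⇒Viable k v d)) none
  ... | yes some with find some
  ...   | (_ , β) , p′ , refl , viable with β ≟SF α
  ...     | yes refl = refl
  ...     | no β≢α = ⊥-elim (ll A β α p′ p β≢α (take k (x ++ v))
              (Viable⇒Select k β _ le viable) (Viable⇒Select k α _ le (Yields⇒Viable k v d)))
    where
    le : length (take k (x ++ v)) ≤ k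
    le = ≤-trans (≤-reflexive (Listₚ.length-take k (x ++ v))) (m⊓n≤m k _)

-- Leftmost derivations of bounded rank.

module Leftmost {T : ℕ} (G : Grammar T) (b : ℕ) where
  open Grammar G

  -- A leftmost derivation in which leading terminals are dropped once passed; this leaves the
  -- number of nonterminals unchanged, so recording the bound at expansions is enough.
  data Rewrites : SF G → List (Fin T) → Set where
    []   : Rewrites [] []
    term : ∀ {a γ z} → Rewrites γ z → Rewrites (inj₂ a ∷ γ) (a ∷ z)
    prod : ∀ {A α γ z} → (A , α) ∈ P → countNT G (inj₁ A ∷ γ) ≤ b → Rewrites (α ++ γ) z →
           Rewrites (inj₁ A ∷ γ) z

  countNT-terminals : ∀ u γ → countNT G (terminals G u ++ γ) ≡ countNT G γ
  countNT-terminals [] γ = refl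
  countNT-terminals (_ ∷ u) γ = countNT-terminals u γ

  countT : SF G → ℕ
  countT [] = 0
  countT (inj₁ _ ∷ γ) = countT γ
  countT (inj₂ _ ∷ γ) = suc (countT γ)

  countT-++ : ∀ γ δ → countT δ ≤ countT (γ ++ δ)
  countT-++ [] δ = ≤-refl
  countT-++ (inj₁ _ ∷ γ) δ = countT-++ γ δ
  countT-++ (inj₂ _ ∷ γ) δ = m≤n⇒m≤1+n (countT-++ γ δ)

  Rewrites-rank : ∀ {γ z} → Rewrites γ z → countNT G γ ≤ b
  Rewrites-rank [] = z≤n
  Rewrites-rank (term d) = Rewrites-rank d
  Rewrites-rank (prod _ le _) = le

  -- Terminals are never erased by later steps. The lengths kept on the stack are therefore bounded
  -- by the input length.
  Rewrites-length : ∀ {γ z} → Rewrites γ z → countT γ ≤ length z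
  Rewrites-length [] = z≤n
  Rewrites-length (term d) = s≤s (Rewrites-length d)
  Rewrites-length (prod {α = α} {γ} _ _ d) = ≤-trans (countT-++ α γ) (Rewrites-length d)

  Rewrites-terminals : ∀ u {γ z} → Rewrites γ z → Rewrites (terminals G u ++ γ) (u ++ z)
  Rewrites-terminals [] d = d
  Rewrites-terminals (_ ∷ u) d = term (Rewrites-terminals u d)

  Rewrites⇒Yields : ∀ {δ z} → Rewrites δ z → ∃[ h ] Yields G h δ z
  Rewrites⇒Yields [] = 0 , []
  Rewrites⇒Yields (term d) with Rewrites⇒Yields d
  ... | h , y = h , term y
  Rewrites⇒Yields (prod {α = α} p _ d) with Rewrites⇒Yields d
  ... | h , y with Yields-split G α y
  ...   | _ , _ , refl , yα , yγ = suc h , prod p yα (Yields-suc G yγ)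

  terminals-prefix : ∀ u u′ {A β γ} → terminals G u′ ++ inj₁ A ∷ β ≡ terminals G u ++ γ →
                     ∃[ u″ ] u′ ≡ u ++ u″ × γ ≡ terminals G u″ ++ inj₁ A ∷ β
  terminals-prefix [] u′ eq = u′ , refl , sym eq
  terminals-prefix (a ∷ u) (a′ ∷ u′) eq with Listₚ.∷-injective eq
  ... | refl , eq′ with terminals-prefix u u′ eq′
  ...   | u″ , refl , eqγ = u″ , refl , eqγ

  terminals-rewrite : ∀ u w {γ} → terminals G w ≡ terminals G u ++ γ → ∃[ v ] w ≡ u ++ v × Rewrites γ v
  terminals-rewrite [] w refl = w , refl , subst₂ Rewrites (++-identityʳ _) (++-identityʳ w) (Rewrites-terminals w [])
  terminals-rewrite (a ∷ u) (a′ ∷ w) eq with Listₚ.∷-injective eq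
  ... | refl , eq′ with terminals-rewrite u w eq′
  ...   | v , refl , d = v , refl , d

  -- The leftmost nonterminal lies beyond any terminal prefix `u`, so every step respects the split
  -- at `u` and the prefix can be stripped.
  LMSeq⇒Rewrites : ∀ {δ w forms} → LMSeq G δ (terminals G w) forms → All (λ γ → countNT G γ ≤ b) forms →
                   ∀ u {γ} → δ ≡ terminals G u ++ γ → ∃[ v ] w ≡ u ++ v × Rewrites γ v
  LMSeq⇒Rewrites {w = w} seq bounds u eq = go seq refl bounds u eq
    where
    -- The final form is a variable with an equation, so that `done` can be matched.
    go : ∀ {δ ω forms} → LMSeq G δ ω forms → ω ≡ terminals G w → All (λ γ → countNT G γ ≤ b) forms →
         ∀ u {γ} → δ ≡ terminals G u ++ γ → ∃[ v ] w ≡ u ++ v × Rewrites γ v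
    go (done _) refl _ u eq = terminals-rewrite u w eq
    go (more _ _ _ _ (lmstep u′ A α β p) seq) eqω (le ∷ les) u eq
      with go seq eqω les u′ refl | terminals-prefix u u′ eq
    ... | v , refl , d | u″ , refl , refl = u″ ++ v , ++-assoc u u″ v
        , Rewrites-terminals u″ (prod p (subst (_≤ b) (countNT-terminals (u ++ u″) _) le) d)

  Reachable : SF G → Set
  Reachable γ = ∃[ forms ] LMSeq G (inj₁ S ∷ []) γ forms × All (λ γ → countNT G γ ≤ b) forms

  LMSeq-snoc : ∀ {γ δ ζ forms} → LMSeq G γ δ forms → LMStep G δ ζ → LMSeq G γ ζ (forms ++ ζ ∷ [])
  LMSeq-snoc (done γ) s = more γ _ _ _ s (done _)
  LMSeq-snoc (more γ δ _ forms s seq) s′ = more γ δ _ _ s (LMSeq-snoc seq s′)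

  Reachable-step : ∀ {γ δ} → Reachable γ → LMStep G γ δ → countNT G δ ≤ b → Reachable δ
  Reachable-step (forms , seq , les) s le = _ , LMSeq-snoc seq s , Allₚ.++⁺ les (le ∷ [])

-- The simulating machine.

-- A nonterminal on the stack carries the length and the hash of the terminals
-- that separate it from the next one.  The terminals on top of the stack are
-- represented by skip, which counts those not yet consumed from the input;
-- their hash is already in output.
module Machine {T : ℕ} (G : Grammar T) (k n b fuel : ℕ) (H : Hash T) where
  open Grammar G
  open Hash H

  Block Entry : Set
  Block = ℕ × Carrier
  Entry = Fin nN × Block

  -- `input` hashes the symbols read so far, `output` the terminals derived so far; the second word
  -- is `skip` symbols longer.
  record Core : Set where
    constructor core
    field
      skip   : ℕ
      input  : Carrier
      output : Carrier
      stack  : List Entry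

  -- A block followed by a stack represents a sentential form split at its first nonterminal; α is
  -- placed in front of it.
  push : SF G → Block × List Entry → Block × List Entry
  push []           c = c
  push (inj₁ A ∷ α) c = let B , st = push α c in (0 , ε) , (A , B) ∷ st
  push (inj₂ a ∷ α) c = let (ℓ , x) , st = push α c in (suc ℓ , letter a · x) , st

  lengths : List Entry → List ℕ
  lengths = map (proj₁ ∘ proj₂)

  -- The stack has one entry per nonterminal, so its height is the quantity bounded by the rank. The
  -- other bounds let every length fit into O(log n) bits.
  Bounded : ℕ → List ℕ → Set
  Bounded m ℓs = m ≤ n × length ℓs ≤ b × All (_≤ n) ℓs

  bounded? : ∀ m ℓs → Dec (Bounded m ℓs)
  bounded? m ℓs = (m ≤? n) ×-dec (length ℓs ≤? b) ×-dec All.all? (_≤? n) ℓs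

  Fits : Core → Set
  Fits (core m _ _ st) = Bounded m (lengths st)

  checked : Core → Maybe Core
  checked s@(core m _ _ st) = if does (bounded? m (lengths st)) then just s else nothing

  expand : SF G → Core → Maybe Core
  expand α s@(core _ _ _ []) = just s
  expand α (core _ i o ((_ , B) ∷ st)) = let (ℓ , x) , st′ = push α (B , st) in checked (core ℓ i (o · x) st′)

  micro : List (Fin T) → Core → Maybe Core
  micro u s@(core zero _ _ ((A , _) ∷ _)) = choose G k A u >>= λ α → expand α s
  micro u s@(core zero _ _ []) = just s
  micro u s@(core (suc _) _ _ _) = just s

  -- Configurations that await input or are finished are fixed by `micro`, so the surplus iterations
  -- are harmless. One still expanding at the end has zero `skip` and a nonempty stack, and `absorb`
  -- and `finish` reject it.
  settle : List (Fin T) → Core → Maybe Core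
  settle u s = fold (just s) (_>>= micro u) fuel

  absorb : Fin T → Core → Maybe Core
  absorb a (core zero i o st) = nothing
  absorb a (core (suc m) i o st) = just (core m (i · letter a) o st)

  finish : Core → Maybe (Carrier × Carrier)
  finish (core zero i o []) = just (i , o)
  finish (core zero i o (_ ∷ _)) = nothing
  finish (core (suc _) i o _) = nothing

  consume : List (Fin T) → Fin T → Core → Maybe Core
  consume u a s = settle u s >>= absorb a

  execute : Core → List (Fin T) → Maybe (Carrier × Carrier)
  execute s []      = settle [] s >>= finish
  execute s (a ∷ z) = consume (take k (a ∷ z)) a s >>= λ s′ → execute s′ z

  start : Core
  start = core 0 ε ε ((S , 0 , ε) ∷ [])

  start-fits : 1 ≤ b → Fits start
  start-fits 1≤b = z≤n , 1≤b , z≤n ∷ []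

  checked-fits : ∀ s → MAll.All Fits (checked s)
  checked-fits s@(core m _ _ st) = go (bounded? m (lengths st))
    where
    go : (f? : Dec (Fits s)) → MAll.All Fits (if does f? then just s else nothing)
    go (yes f) = MAll.just f
    go (no _)  = MAll.nothing

  micro-fits : ∀ u s → Fits s → MAll.All Fits (micro u s)
  micro-fits u (core zero i o []) f = MAll.just f
  micro-fits u (core (suc _) i o st) f = MAll.just f
  micro-fits u (core zero i o ((A , B) ∷ st)) f with choose G k A u
  ... | nothing = MAll.nothing
  ... | just α = checked-fits _

  fold-fits : ∀ u s → Fits s → ∀ m → MAll.All Fits (fold (just s) (_>>= micro u) m)
  fold-fits u s f zero = MAll.just f
  fold-fits u s f (suc m) with fold (just s) (_>>= micro u) m | fold-fits u s f m
  ... | nothing | _ = MAll.nothing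
  ... | just s′ | MAll.just f′ = micro-fits u s′ f′

  absorb-fits : ∀ a s → Fits s → MAll.All Fits (absorb a s)
  absorb-fits a (core zero _ _ _) f = MAll.nothing
  absorb-fits a (core (suc m) _ _ _) (p , q) = MAll.just (≤-trans (n≤1+n m) p , q)

  consume-fits : ∀ u a s → Fits s → MAll.All Fits (consume u a s)
  consume-fits u a s f with settle u s | fold-fits u s f fuel
  ... | nothing | _ = MAll.nothing
  ... | just s′ | MAll.just f′ = absorb-fits a s′ f′

  data Ready : Maybe Core → Set where
    pending : ∀ {m i o st} → Ready (just (core (suc m) i o st))
    empty   : ∀ {i o} → Ready (just (core zero i o []))

  ready-fixed : ∀ u {s} → Ready s → (s >>= micro u) ≡ s
  ready-fixed u pending = refl
  ready-fixed u empty = refl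

  ready-stable : ∀ u s {i} j → i ≤′ j → Ready (fold s (_>>= micro u) i) →
                 fold s (_>>= micro u) j ≡ fold s (_>>= micro u) i
  ready-stable u s j ≤′-refl r = refl
  ready-stable u s (suc j) (≤′-step le) r =
    trans (cong (_>>= micro u) (ready-stable u s j le r)) (ready-fixed u r)

  -- By finiteness, a run that ever becomes ready does so within `2 ^ suc m` steps. Readiness is
  -- permanent, so the configurations after `t` and after `fuel` steps agree.
  settle-ready : ∀ {m} → Code Fits m → 2 ^ suc m ≤ fuel → ∀ u s → Fits s → ∀ t →
                 Ready (fold (just s) (_>>= micro u) t) → settle u s ≡ fold (just s) (_>>= micro u) t
  settle-ready {m} c le u s f t r with t ≤? fuel
  ... | yes t≤ = ready-stable u (just s) fuel (≤⇒≤′ t≤) r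
  ... | no ¬t≤ with orbit-hit (maybeC c) (_>>= micro u) (just s) (fold-fits u s f) Ready t r
  ...   | t′ , t′< , r′ = trans (ready-stable u (just s) fuel (≤⇒≤′ t′≤) r′)
                                (sym (ready-stable u (just s) t (≤⇒≤′ (≤-trans t′≤ (≰⇒≥ ¬t≤))) r′))
    where
    t′≤ : t′ ≤ fuel
    t′≤ = ≤-trans (<⇒≤ t′<) le

-- The control flow does not depend on the hash, so hashing commutes with
-- execution.
module Hashing {T : ℕ} (G : Grammar T) (k n b fuel : ℕ) (H : Hash T)
  (hash-++ : ∀ x y → Hash.hash H (x ++ y) ≡ Hash._·_ H (Hash.hash H x) (Hash.hash H y))
  (hash-letter : ∀ a → Hash.hash H (a ∷ []) ≡ Hash.letter H a) where
  open Hash H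
  module F = Machine G k n b fuel (free T)
  module M = Machine G k n b fuel H
  open F using (core)

  hashBlock : F.Block → M.Block
  hashBlock (ℓ , x) = ℓ , hash x

  hashEntry : F.Entry → M.Entry
  hashEntry (A , B) = A , hashBlock B

  hashCore : F.Core → M.Core
  hashCore (core m i o st) = M.core m (hash i) (hash o) (map hashEntry st)

  hashPair : F.Block × List F.Entry → M.Block × List M.Entry
  hashPair (B , st) = hashBlock B , map hashEntry st

  push-hash : ∀ α c → M.push α (hashPair c) ≡ hashPair (F.push α c)
  push-hash [] c = refl
  push-hash (inj₁ A ∷ α) c rewrite push-hash α c = refl
  push-hash (inj₂ a ∷ α) c rewrite push-hash α c = refl

  lengths-hash : ∀ st → M.lengths (map hashEntry st) ≡ F.lengths st
  lengths-hash st = sym (map-∘ st)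

  fits-hash : ∀ s → F.Fits s → M.Fits (hashCore s)
  fits-hash (core m i o st) f rewrite lengths-hash st = f

  checked-hash : ∀ s → M.checked (hashCore s) ≡ Maybe.map hashCore (F.checked s)
  checked-hash (core m i o st) rewrite lengths-hash st with does (F.bounded? m (F.lengths st))
  ... | true = refl
  ... | false = refl

  expand-hash : ∀ α s → M.expand α (hashCore s) ≡ Maybe.map hashCore (F.expand α s)
  expand-hash α (core m i o []) = refl
  expand-hash α (core m i o ((A , B) ∷ st)) rewrite push-hash α (B , st) =
    trans (cong (λ y → M.checked (M.core _ (hash i) y _)) (sym (hash-++ o _))) (checked-hash _)

  micro-hash : ∀ u s → M.micro u (hashCore s) ≡ Maybe.map hashCore (F.micro u s)
  micro-hash u (core (suc m) i o st) = refl
  micro-hash u (core zero i o []) = refl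
  micro-hash u s@(core zero i o ((A , B) ∷ st)) with choose G k A u
  ... | nothing = refl
  ... | just α = expand-hash α s

  fold-hash : ∀ u s m → fold (just (hashCore s)) (_>>= M.micro u) m ≡ Maybe.map hashCore (fold (just s) (_>>= F.micro u) m)
  fold-hash u s zero = refl
  fold-hash u s (suc m) rewrite fold-hash u s m with fold (just s) (_>>= F.micro u) m
  ... | nothing = refl
  ... | just s′ = micro-hash u s′

  absorb-hash : ∀ a s → M.absorb a (hashCore s) ≡ Maybe.map hashCore (F.absorb a s)
  absorb-hash a (core zero i o st) = refl
  absorb-hash a (core (suc m) i o st) =
    cong (λ x → just (M.core m x (hash o) _)) (trans (cong (hash i ·_) (sym (hash-letter a))) (sym (hash-++ i (a ∷ []))))

  hashResult : List (Fin T) × List (Fin T) → Carrier × Carrier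
  hashResult (i , o) = hash i , hash o

  finish-hash : ∀ s → M.finish (hashCore s) ≡ Maybe.map hashResult (F.finish s)
  finish-hash (core zero i o []) = refl
  finish-hash (core zero i o (_ ∷ _)) = refl
  finish-hash (core (suc m) i o st) = refl

  execute-hash : ∀ s z → M.execute (hashCore s) z ≡ Maybe.map hashResult (F.execute s z)
  execute-hash s [] rewrite fold-hash [] s fuel with fold (just s) (_>>= F.micro []) fuel
  ... | nothing = refl
  ... | just s′ = finish-hash s′
  execute-hash s (a ∷ z) rewrite fold-hash (take k (a ∷ z)) s fuel with fold (just s) (_>>= F.micro (take k (a ∷ z))) fuel
  ... | nothing = refl
  ... | just s′ rewrite absorb-hash a s′ with F.absorb a s′
  ...   | nothing = refl
  ...   | just s″ = execute-hash s″ z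

-- The machine run over words: soundness, and progress along a derivation.

module Correct {T : ℕ} (G : Grammar T) (k n b fuel : ℕ) where
  open Grammar G
  open Leftmost G b
  open Machine G k n b fuel (free T)

  flatten : List Entry → SF G
  flatten [] = []
  flatten ((A , _ , x) ∷ st) = inj₁ A ∷ terminals G x ++ flatten st

  flattenPair : Block × List Entry → SF G
  flattenPair ((_ , x) , st) = terminals G x ++ flatten st

  Sound : Block → Set
  Sound (ℓ , x) = ℓ ≡ length x

  SoundStack : List Entry → Set
  SoundStack = All (Sound ∘ proj₂)

  push-flatten : ∀ α c → flattenPair (push α c) ≡ α ++ flattenPair c
  push-flatten [] c = refl
  push-flatten (inj₁ A ∷ α) c = cong (inj₁ A ∷_) (push-flatten α c)
  push-flatten (inj₂ a ∷ α) c = cong (inj₂ a ∷_) (push-flatten α c)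

  push-sound : ∀ α {B st} → Sound B → SoundStack st →
               Sound (proj₁ (push α (B , st))) × SoundStack (proj₂ (push α (B , st)))
  push-sound [] p ps = p , ps
  push-sound (inj₁ A ∷ α) p ps with push-sound α p ps
  ... | q , qs = refl , q ∷ qs
  push-sound (inj₂ a ∷ α) p ps with push-sound α p ps
  ... | q , qs = cong suc q , qs

  countNT-flatten : ∀ st → countNT G (flatten st) ≡ length (lengths st)
  countNT-flatten [] = refl
  countNT-flatten ((A , _ , x) ∷ st) = cong suc (trans (countNT-terminals x _) (countNT-flatten st))

  countT-terminals : ∀ x γ → length x ≤ countT (terminals G x ++ γ)
  countT-terminals [] γ = z≤n
  countT-terminals (_ ∷ x) γ = s≤s (countT-terminals x γ)

  lengths-flatten : ∀ st → SoundStack st → All (_≤ countT (flatten st)) (lengths st)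
  lengths-flatten [] [] = []
  lengths-flatten ((A , _ , x) ∷ st) (refl ∷ ps) = countT-terminals x _ ∷
    All.map (λ le → ≤-trans le (countT-++ (terminals G x) (flatten st))) (lengths-flatten st ps)

  checked-just : ∀ s {s′} → checked s ≡ just s′ → Fits s × s ≡ s′
  checked-just s@(core m _ _ st) = go (bounded? m (lengths st))
    where
    go : (f? : Dec (Fits s)) → ∀ {s′} → (if does f? then just s else nothing) ≡ just s′ → Fits s × s ≡ s′
    go (yes f) refl = f , refl

  fits-checked : ∀ s → Fits s → checked s ≡ just s
  fits-checked (core m _ _ st) f rewrite dec-true (bounded? m (lengths st)) f = refl

  -- The derived word is tied to the symbols read by its length alone; agreement of letters is left
  -- to the final comparison.
  record Invariant (read : List (Fin T)) (s : Core) : Set where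
    open Core s
    field
      input≡    : input ≡ read
      length≡   : length output ≡ length read + skip
      sound     : SoundStack stack
      reachable : Reachable (terminals G output ++ flatten stack)

  expand-step : ∀ o A α x st → let (_ , x′) , st′ = push α ((length x , x) , st) in (A , α) ∈ P →
                LMStep G (terminals G o ++ inj₁ A ∷ terminals G x ++ flatten st) (terminals G (o ++ x′) ++ flatten st′)
  expand-step o A α x st p = subst (LMStep G _) eq (lmstep o A α (terminals G x ++ flatten st) p)
    where
    open ≡-Reasoning
    x′ = proj₂ (proj₁ (push α ((length x , x) , st)))
    st′ = proj₂ (push α ((length x , x) , st))
    eq : terminals G o ++ α ++ terminals G x ++ flatten st ≡ terminals G (o ++ x′) ++ flatten st′
    eq = begin
      terminals G o ++ α ++ terminals G x ++ flatten st     ≡⟨ cong (terminals G o ++_) (push-flatten α ((length x , x) , st)) ⟨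
      terminals G o ++ terminals G x′ ++ flatten st′        ≡⟨ ++-assoc (terminals G o) (terminals G x′) (flatten st′) ⟨
      (terminals G o ++ terminals G x′) ++ flatten st′      ≡⟨ cong (_++ flatten st′) (map-++ inj₂ o x′) ⟨
      terminals G (o ++ x′) ++ flatten st′                  ∎

  micro-invariant : ∀ {read} u s {s′} → Invariant read s → micro u s ≡ just s′ → Invariant read s′
  micro-invariant u (core (suc m) i o st) inv refl = inv
  micro-invariant u (core zero i o []) inv refl = inv
  micro-invariant {read} u (core zero i o ((A , ℓ , x) ∷ st)) {s′} inv eq = go _ refl eq
    where
    s : Core
    s = core zero i o ((A , ℓ , x) ∷ st)
    grown : SF G → Core
    grown α = let (m , y) , st′ = push α ((ℓ , x) , st) in core m i (o ++ y) st′
    expanded : ∀ {α} → (A , α) ∈ P → Fits (grown α) × grown α ≡ s′ → SoundStack ((A , ℓ , x) ∷ st) → Invariant read s′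
    expanded {α} p ((_ , le , _) , refl) (refl ∷ ps) = record
      { input≡ = Invariant.input≡ inv
      ; length≡ = trans (length-++ o) (cong₂ _+_ (trans (Invariant.length≡ inv) (+-identityʳ _)) (sym (proj₁ snd)))
      ; sound = proj₂ snd
      ; reachable = Reachable-step (Invariant.reachable inv) (expand-step o A α x st p)
          (≤-trans (≤-reflexive (trans (countNT-terminals (o ++ _) _) (countNT-flatten (proj₂ (push α ((length x , x) , st)))))) le)
      }
      where
      snd = push-sound α {length x , x} {st} refl ps
    go : ∀ c → choose G k A u ≡ c → (c >>= λ α → expand α s) ≡ just s′ → Invariant read s′
    go (just α) chosen eq = expanded (choose-∈ G k A u chosen) (checked-just (grown α) eq) (Invariant.sound inv)

  fold-invariant : ∀ {read} u s → Invariant read s → ∀ m {s′} → fold (just s) (_>>= micro u) m ≡ just s′ → Invariant read s′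
  fold-invariant u s inv zero refl = inv
  fold-invariant u s inv (suc m) eq with fold (just s) (_>>= micro u) m in eq₁
  ... | just s₁ = micro-invariant u s₁ (fold-invariant u s inv m eq₁) eq

  absorb-invariant : ∀ {read} a s {s′} → Invariant read s → absorb a s ≡ just s′ → Invariant (read ++ a ∷ []) s′
  absorb-invariant {read} a (core (suc m) i o st) inv refl = record
    { input≡ = cong (_++ a ∷ []) (Invariant.input≡ inv)
    ; length≡ = trans (Invariant.length≡ inv) (trans (+-suc (length read) m)
        (cong (_+ m) (trans (sym (+-comm (length read) 1)) (sym (length-++ read)))))
    ; sound = Invariant.sound inv
    ; reachable = Invariant.reachable inv
    }

  -- At the end `skip` is zero and the stack is empty, so the reachable form is `o` itself. It may
  -- differ from the input.
  execute-sound : ∀ read s z {i o} → Invariant read s → execute s z ≡ just (i , o) →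
                  i ≡ read ++ z × length o ≡ length (read ++ z) × InLangRankAtMost G b o
  execute-sound read s [] inv eq with settle [] s in eq₁
  ... | just (core zero i o []) with refl ← eq | fold-invariant [] s inv fuel eq₁
  ...   | inv′ = trans (Invariant.input≡ inv′) (sym (++-identityʳ read))
               , trans (Invariant.length≡ inv′) (trans (+-identityʳ _) (cong length (sym (++-identityʳ read))))
               , subst Reachable (++-identityʳ _) (Invariant.reachable inv′)
  execute-sound read s (a ∷ z) inv eq with settle (take k (a ∷ z)) s in eq₁
  ... | just s₁ with absorb a s₁ in eq₂
  ...   | just s₂ with execute-sound (read ++ a ∷ []) s₂ z (absorb-invariant a s₁ (fold-invariant _ s inv fuel eq₁) eq₂) eq
  ...     | p , q , r = trans p (++-assoc read (a ∷ []) z) , trans q (cong length (++-assoc read (a ∷ []) z)) , r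

  start-invariant : 1 ≤ b → Invariant [] start
  start-invariant 1≤b = record
    { input≡ = refl ; length≡ = refl ; sound = refl ∷ []
    ; reachable = _ , done _ , 1≤b ∷ [] }

  -- Induction on the derivation: each expansion made by the machine is the recorded one, until a
  -- terminal comes to the front or nothing is left.
  settles : IsLL G k → ∀ {δ z} → Rewrites δ z → length z ≤ n → ∀ read x st → δ ≡ terminals G x ++ flatten st → SoundStack st →
            ∃[ t ] ∃[ x′ ] ∃[ st′ ] let s′ = just (core (length x′) read (read ++ x′) st′) in
            fold (just (core (length x) read (read ++ x) st)) (_>>= micro (take k z)) t ≡ s′
            × Ready s′ × Rewrites (terminals G x′ ++ flatten st′) z × SoundStack st′
  settles ll d le read x@(_ ∷ _) st refl ps = 0 , x , st , refl , pending , d , ps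
  settles ll d le read [] [] refl ps = 0 , [] , [] , refl , empty , d , ps
  settles ll (prod {A} {α} {γ} {z} p r d) le read [] ((A , ℓ , x) ∷ st) refl (refl ∷ ps)
    with settles ll d le read (proj₂ (proj₁ (push α ((length x , x) , st)))) (proj₂ (push α ((length x , x) , st)))
           (sym (push-flatten α ((length x , x) , st))) (proj₂ (push-sound α {length x , x} {st} refl ps))
  -- The added step is the innermost iterate, the expansion computed in `first`.
  ... | t , x′ , st′ , eq , ready , d′ , ps′ = t + 1 , x′ , st′
      , trans (fold-+ _ _ t) (trans (cong (λ s → fold s (_>>= micro (take k z)) t) first) eq) , ready , d′ , ps′
    where
    snd = push-sound α {length x , x} {st} refl ps
    x₁ = proj₂ (proj₁ (push α ((length x , x) , st)))
    st₁ = proj₂ (push α ((length x , x) , st))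
    d₁ : Rewrites (terminals G x₁ ++ flatten st₁) z
    d₁ = subst (λ δ → Rewrites δ z) (sym (push-flatten α ((length x , x) , st))) d
    -- All blocks consist of terminals of one form deriving `z`, and the stack entries are the
    -- nonterminals of that form.
    fits : Bounded (length x₁) (lengths st₁)
    fits = ≤-trans (countT-terminals x₁ _) (≤-trans (Rewrites-length d₁) le)
         , ≤-trans (≤-reflexive (sym (trans (countNT-terminals x₁ _) (countNT-flatten st₁)))) (Rewrites-rank d₁)
         , All.map (λ q → ≤-trans q (≤-trans (countT-++ (terminals G x₁) _) (≤-trans (Rewrites-length d₁) le))) (lengths-flatten st₁ (proj₂ snd))
    -- α derives a prefix of `z`, and the rest of `z` serves as the continuation.
    chosen : choose G k A (take k z) ≡ just α
    chosen = let _ , y = Rewrites⇒Yields d in select (Yields-split G α y)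
      where
      select : ∀ {h} → ∃[ u ] ∃[ v ] z ≡ u ++ v × Yields G h α u × Yields G h γ v → choose G k A (take k z) ≡ just α
      select (_ , v , refl , yα , _) = choose-complete G ll v p yα
    first : micro (take k z) (core 0 read (read ++ []) ((A , length x , x) ∷ st)) ≡ just (core (length x₁) read (read ++ x₁) st₁)
    first = trans (cong (_>>= λ α → expand α (core 0 read (read ++ []) ((A , length x , x) ∷ st))) chosen)
      (trans (cong (λ m → checked (core m read ((read ++ []) ++ x₁) st₁)) (proj₁ snd))
      (trans (fits-checked _ fits) (cong (λ o → just (core (length x₁) read o st₁)) (cong (_++ x₁) (++-identityʳ read)))))

  absorb-rewrites : ∀ a {z} read x st → Ready (just (core (length x) read (read ++ x) st)) →
                    Rewrites (terminals G x ++ flatten st) (a ∷ z) → ∃[ x′ ] (x ≡ a ∷ x′) × Rewrites (terminals G x′ ++ flatten st) z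
  absorb-rewrites a read (_ ∷ x) st pending (term d) = x , refl , d
  absorb-rewrites a read [] [] empty ()

-- Completeness on words of bounded rank.

module Complete {T : ℕ} (G : Grammar T) (k n b fuel : ℕ) (H : Hash T)
  (hash-++ : ∀ x y → Hash.hash H (x ++ y) ≡ Hash._·_ H (Hash.hash H x) (Hash.hash H y))
  (hash-letter : ∀ a → Hash.hash H (a ∷ []) ≡ Hash.letter H a)
  {m} (c : Code (Machine.Fits G k n b fuel H) m) (enough : 2 ^ suc m ≤ fuel) (ll : IsLL G k) where
  open Grammar G
  open Hash H using (hash)
  open Leftmost G b
  open Correct G k n b fuel
  open Hashing G k n b fuel H hash-++ hash-letter
  open F using (core)

  ready-hash : ∀ {s} → F.Ready (just s) → M.Ready (just (hashCore s))
  ready-hash F.pending = M.pending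
  ready-hash F.empty = M.empty

  state : List (Fin T) → List (Fin T) → List F.Entry → F.Core
  state read x st = core (length x) read (read ++ x) st

  settle-complete : ∀ {z} read x st → length z ≤ n → F.Fits (state read x st) → SoundStack st → Rewrites (terminals G x ++ flatten st) z →
    ∃[ x′ ] ∃[ st′ ] M.settle (take k z) (hashCore (state read x st)) ≡ just (hashCore (state read x′ st′))
      × F.Ready (just (state read x′ st′)) × F.Fits (state read x′ st′) × SoundStack st′ × Rewrites (terminals G x′ ++ flatten st′) z
  settle-complete {z} read x st le f ps d with settles ll d le read x st refl ps
  ... | t , x′ , st′ , eq , ready , d′ , ps′ = x′ , st′
      , trans (M.settle-ready c enough (take k z) _ (fits-hash (state read x st) f) t (subst M.Ready (sym eq′) (ready-hash ready))) eq′
      , ready , drop-just (subst (MAll.All F.Fits) eq (F.fold-fits (take k z) _ f t)) , ps′ , d′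
    where
    eq′ : fold (just (hashCore (state read x st))) (_>>= M.micro (take k z)) t ≡ just (hashCore (state read x′ st′))
    eq′ = trans (fold-hash (take k z) (state read x st) t) (cong (Maybe.map hashCore) eq)
    drop-just : ∀ {s} → MAll.All F.Fits (just s) → F.Fits s
    drop-just (MAll.just f) = f

  -- Here the derived word is forced to follow the input: it is what has been read followed by the
  -- pending terminals `x`, which begin the remaining input. Both final hashes are then of the same
  -- word.
  execute-complete : ∀ read x st z → length z ≤ n → F.Fits (state read x st) → SoundStack st → Rewrites (terminals G x ++ flatten st) z →
    M.execute (hashCore (state read x st)) z ≡ just (hash (read ++ z) , hash (read ++ z))
  execute-complete read x st [] le f ps d with settle-complete read x st le f ps d
  ... | x′ , st′ , eq , ready , f′ , ps′ , d′ rewrite Listₚ.take-[] {A = Fin T} k | eq = last x′ st′ ready d′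
    where
    last : ∀ x st → F.Ready (just (state read x st)) → Rewrites (terminals G x ++ flatten st) [] →
           M.finish (hashCore (state read x st)) ≡ just (hash (read ++ []) , hash (read ++ []))
    last [] [] F.empty [] = cong (λ y → just (hash y , hash (read ++ []))) (sym (++-identityʳ read))
    last (_ ∷ _) st F.pending ()
  execute-complete read x st (a ∷ z) le f ps d with settle-complete read x st le f ps d
  ... | x′ , st′ , eq , ready , f′ , ps′ , d′ with absorb-rewrites a read x′ st′ ready d′
  ...   | x″ , refl , d″ = trans (cong (λ s → (s >>= M.absorb a) >>= λ s′ → M.execute s′ z) eq)
          (trans (cong (_>>= λ s′ → M.execute s′ z) (absorb-hash a (state read (a ∷ x″) st′)))
          (trans (cong (λ o → M.execute (hashCore (core (length x″) (read ++ a ∷ []) o st′)) z) (sym (++-assoc read (a ∷ []) x″)))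
          (trans (execute-complete (read ++ a ∷ []) x″ st′ z (≤-trans (n≤1+n _) le) (≤-trans (n≤1+n _) (proj₁ f′) , proj₂ f′) ps′ d″)
          (cong (λ y → just (hash y , hash y)) (++-assoc read (a ∷ []) z)))))

  start-complete : 1 ≤ b → ∀ w → length w ≤ n → InLangRankAtMost G b w →
    M.execute (hashCore F.start) w ≡ just (hash w , hash w)
  start-complete 1≤b w le (forms , seq , bounds) with LMSeq⇒Rewrites seq bounds [] refl
  ... | _ , refl , d = execute-complete [] [] ((S , 0 , []) ∷ []) w le (F.start-fits 1≤b) (refl ∷ []) d

-- Logarithms, and counting strings of coins.

n<2^n : ∀ n → n < 2 ^ n
n<2^n zero = s≤s z≤n
n<2^n (suc n) = ≤-trans (+-mono-≤ (m^n>0 2 n) (n<2^n n)) (≤-reflexive (cong (2 ^ n +_) (sym (+-identityʳ (2 ^ n)))))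

n<2^[1+log₂n] : ∀ n → n < 2 ^ suc ⌊log₂ n ⌋
n<2^[1+log₂n] n with n <? 2 ^ suc ⌊log₂ n ⌋
... | yes lt = lt
... | no ¬lt = contradiction (≤-trans (≤-reflexive (sym (⌊log₂[2^n]⌋≡n (suc ⌊log₂ n ⌋)))) (⌊log₂⌋-mono-≤ (≮⇒≥ ¬lt))) (<-irrefl refl)

indicator : Bool → ℕ
indicator c = if c then 1 else 0

sum-const : ∀ {A : Set} (f : A → ℕ) c xs → (∀ x → f x ≡ c) → sum (map f xs) ≡ c * length xs
sum-const f c [] eq = sym (*-zeroʳ c)
sum-const f c (x ∷ xs) eq = trans (cong₂ _+_ (eq x) (sum-const f c xs eq)) (sym (*-suc c (length xs)))

sum-indicator : ∀ {A : Set} (p : A → Bool) xs → sum (map (indicator ∘ p) xs) ≡ length (filter (λ x → p x Boolₚ.≟ true) xs)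
sum-indicator p [] = refl
sum-indicator p (x ∷ xs) with p x
... | true = cong suc (sum-indicator p xs)
... | false = sum-indicator p xs

module _ {A : Set} {m : ℕ} (zs : List (Vec A m)) where

  length-extend : ∀ xs → length (concatMap (λ x → map (x ∷v_) zs) xs) ≡ length xs * length zs
  length-extend [] = refl
  length-extend (x ∷ xs) = trans (length-++ (map (x ∷v_) zs)) (cong₂ _+_ (length-map _ zs) (length-extend xs))

  -- Each head is counted once per tail. Since acceptance depends on the first block of coins only,
  -- counting accepting runs reduces to counting seeds.
  sum-extend : ∀ (f : Vec A (suc m) → ℕ) (g : A → ℕ) → (∀ x z → f (x ∷v z) ≡ g x) → ∀ xs →
               sum (map f (concatMap (λ x → map (x ∷v_) zs) xs)) ≡ sum (map g xs) * length zs
  sum-extend f g eq [] = refl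
  sum-extend f g eq (x ∷ xs) = begin
    sum (map f (map (x ∷v_) zs ++ rest))               ≡⟨ cong sum (map-++ f (map (x ∷v_) zs) rest) ⟩
    sum (map f (map (x ∷v_) zs) ++ map f rest)         ≡⟨ sum-++ (map f (map (x ∷v_) zs)) _ ⟩
    sum (map f (map (x ∷v_) zs)) + sum (map f rest)    ≡⟨ cong₂ _+_ (trans (cong sum (sym (map-∘ zs))) (sum-const _ (g x) zs (eq x))) (sum-extend f g eq xs) ⟩
    g x * length zs + sum (map g xs) * length zs       ≡⟨ *-distribʳ-+ (length zs) (g x) (sum (map g xs)) ⟨
    (g x + sum (map g xs)) * length zs                 ∎
    where
    open ≡-Reasoning
    rest = concatMap (λ x → map (x ∷v_) zs) xs

  extend-unique : ∀ {xs} → Unique xs → Unique zs → Unique (concatMap (λ x → map (x ∷v_) zs) xs)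
  extend-unique {xs} ux uz = subst Unique (sym (as-product xs)) (Uniqueₚ.cartesianProductWith⁺ _∷v_ Vecₚ.∷-injective ux uz)
    where
    as-product : ∀ xs → concatMap (λ x → map (x ∷v_) zs) xs ≡ cartesianProductWith _∷v_ xs zs
    as-product [] = refl
    as-product (x ∷ xs) = cong (map (x ∷v_) zs ++_) (as-product xs)

allVec-unique : ∀ {A : Set} {xs : List A} → Unique xs → ∀ m → Unique (allVec xs m)
allVec-unique u zero = [] ∷ []
allVec-unique u (suc m) = extend-unique (allVec _ m) u (allVec-unique u m)

allBits-unique : ∀ m → Unique (allBits m)
allBits-unique = allVec-unique (((λ ()) ∷ []) ∷ [] ∷ [])

length-allBits : ∀ m → length (allBits m) ≡ 2 ^ m
length-allBits zero = refl
length-allBits (suc m) = trans (length-extend (allBits m) (false ∷ true ∷ [])) (cong (2 *_) (length-allBits m))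

-- Streaming with a lookahead buffer and a stored seed.

-- The last k symbols are held back, which gives the machine its lookahead.
module Buffered {T : ℕ} (G : Grammar T) (k n b fuel : ℕ) (H : Hash T) where
  open Machine G k n b fuel H

  State : Set
  State = Maybe (Core × List (Fin T))

  ValidPair : Core × List (Fin T) → Set
  ValidPair (s , u) = Fits s × length u ≤ k × All trivial u

  Valid : State → Set
  Valid = MAll.All ValidPair

  shift : Core → List (Fin T) → State
  shift s []      = nothing
  shift s (a ∷ u) = consume (take k (a ∷ u)) a s >>= λ s′ → just (s′ , u)

  read : Fin T → Core × List (Fin T) → State
  read a (s , u) = if length u <ᵇ k then just (s , u ++ a ∷ []) else shift s (u ++ a ∷ [])

  readAll : State → ∀ {m} → Vec (Fin T) m → State
  readAll x w = Vec.foldl (λ _ → State) (λ x a → x >>= read a) x w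

  -- The result the machine would reach if `w` were still to come; it is the quantity preserved
  -- while symbols move into the buffer.
  outcome : List (Fin T) → State → Maybe (Hash.Carrier H × Hash.Carrier H)
  outcome w x = x >>= λ { (s , u) → execute s (u ++ w) }

  length-snoc : ∀ (u : List (Fin T)) a → length (u ++ a ∷ []) ≡ suc (length u)
  length-snoc u a = trans (length-++ u) (+-comm (length u) 1)

  read-valid : ∀ a {x} → Valid x → Valid (x >>= read a)
  read-valid a MAll.nothing = MAll.nothing
  read-valid a {just (s , u)} (MAll.just (f , le , _)) with length u <ᵇ k in eq
  ... | true = MAll.just (f , ≤-trans (≤-reflexive (length-snoc u a)) (<ᵇ⇒< (length u) k (Equivalence.from Boolₚ.T-≡ eq)) , All.universal (λ _ → tt) _)
  ... | false = shift-valid (u ++ a ∷ []) (≤-trans (≤-reflexive (length-snoc u a)) (s≤s le))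
    where
    shift-valid : ∀ u → length u ≤ suc k → Valid (shift s u)
    shift-valid [] _ = MAll.nothing
    shift-valid (c ∷ u) (s≤s le) with consume (take k (c ∷ u)) c s | consume-fits (take k (c ∷ u)) c s f
    ... | nothing | _ = MAll.nothing
    ... | just s′ | MAll.just f′ = MAll.just (f′ , le , All.universal (λ _ → tt) u)

  take-++ : ∀ m (u : List (Fin T)) w → m ≤ length u → take m (u ++ w) ≡ take m u
  take-++ zero u w le = refl
  take-++ (suc m) (a ∷ u) w (s≤s le) = cong (a ∷_) (take-++ m u w le)

  -- A symbol is consumed only when `k` others are already waiting with the new one behind them, so
  -- the first `k` symbols of the buffer are those of the whole remaining input.
  read-outcome : ∀ a w x → Valid x → outcome w (x >>= read a) ≡ outcome (a ∷ w) x
  read-outcome a w nothing _ = refl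
  read-outcome a w (just (s , u)) (MAll.just (f , le , _)) with length u <ᵇ k in eq
  ... | true = cong (execute s) (++-assoc u (a ∷ []) w)
  ... | false = trans (shifted (u ++ a ∷ []) (≤-reflexive (sym (length-snoc u a))) (≮⇒≥ full))
                  (cong (execute s) (++-assoc u (a ∷ []) w))
    where
    full : ¬ length u < k
    full lt with () ← trans (sym eq) (Equivalence.to Boolₚ.T-≡ (<⇒<ᵇ lt))
    shifted : ∀ v → suc (length u) ≤ length v → k ≤ length u → outcome w (shift s v) ≡ execute s (v ++ w)
    shifted (c ∷ v) le′ k≤ rewrite take-++ k (c ∷ v) w (≤-trans k≤ (≤-trans (n≤1+n _) le′))
      with consume (take k (c ∷ v)) c s
    ... | nothing = refl
    ... | just s′ = refl

  readAll-outcome : ∀ x {m} (w : Vec (Fin T) m) → Valid x → outcome [] (readAll x w) ≡ outcome (toList w) x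
  readAll-outcome x []v v = refl
  readAll-outcome x (a ∷v w) v = trans (readAll-outcome (x >>= read a) w (read-valid a v)) (read-outcome a (toList w) x v)

  initial : State
  initial = just (start , [])

  initial-valid : 1 ≤ b → Valid initial
  initial-valid 1≤b = MAll.just (start-fits 1≤b , z≤n , [])

module _ {T : ℕ} (M : StreamingAlg T) (n b : ℕ) {X : Set} (Valid : X → Set)
  (store : X → Vec Bool (StreamingAlg.space M n b)) (next : X → Fin T → X)
  (step-store : ∀ x a r → Valid x → StreamingAlg.step M n b (store x) a r ≡ store (next x a))
  (next-valid : ∀ x a → Valid x → Valid (next x a)) where

  feed-simulates : ∀ x {m} (w : Vec (Fin T) m) rs → Valid x →
    feed M n b (store x) w rs ≡ store (Vec.foldl (λ _ → X) next x w) × Valid (Vec.foldl (λ _ → X) next x w)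
  feed-simulates x []v []v v = refl , v
  feed-simulates x (a ∷v w) (r ∷v rs) v rewrite step-store x a r v = feed-simulates (next x a) w rs (next-valid x a v)

-- The first block of coins is stored in front of the state; later blocks are
-- ignored.
module Seeded {T c m : ℕ} (State : Vec Bool c → Set) (Valid : ∀ r → State r → Set)
  (encode : ∀ r → State r → Vec Bool m) (decode : ∀ r → Vec Bool m → State r)
  (decode-encode : ∀ r {x} → Valid r x → decode r (encode r x) ≡ x)
  (next : ∀ r → Fin T → State r → State r) (out : ∀ r → State r → Bool) where

  store : ∀ r → State r → Vec Bool (c + m)
  store r x = r Vec.++ encode r x

  stepV : Vec Bool (c + m) → Fin T → Vec Bool (c + m)
  stepV v a = let r = Vec.take c v in store r (next r a (decode r (Vec.drop c v)))

  acceptV : Vec Bool (c + m) → Bool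
  acceptV v = let r = Vec.take c v in out r (decode r (Vec.drop c v))

  take-drop : ∀ (r : Vec Bool c) (v : Vec Bool m) → Vec.take c (r Vec.++ v) ≡ r × Vec.drop c (r Vec.++ v) ≡ v
  take-drop r v = Vecₚ.++-injective (Vec.take c (r Vec.++ v)) r (Vecₚ.take++drop≡id c (r Vec.++ v))

  stepV-store : ∀ r x a → Valid r x → stepV (store r x) a ≡ store r (next r a x)
  stepV-store r x a v rewrite proj₁ (take-drop r (encode r x)) | proj₂ (take-drop r (encode r x)) | decode-encode r v = refl

  acceptV-store : ∀ r x → Valid r x → acceptV (store r x) ≡ out r x
  acceptV-store r x v rewrite proj₁ (take-drop r (encode r x)) | proj₂ (take-drop r (encode r x)) | decode-encode r v = refl

-- Choice of the domain and layout of the memory.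

module Parameters {T : ℕ} (G : Grammar T) (k n b : ℕ) where
  open Grammar G

  L : ℕ
  L = suc ⌊log₂ n ⌋

  -- The dimension exceeds the argument of `domain-of-dim`, hence is at least T + 2L: T makes room
  -- for the letters, 2L for n² evaluation points.
  D : Domain
  D = proj₁ (domain-of-dim (T + (⌊log₂ n ⌋ + L)))

  open Domain D using (dim; point; point-injective; code)

  T+2L≤dim : T + (L + L) ≤ dim
  T+2L≤dim = ≤-trans (≤-reflexive (+-suc T _)) (proj₁ (proj₂ (domain-of-dim (T + (⌊log₂ n ⌋ + L)))))

  T≤2^dim : T ≤ 2 ^ dim
  T≤2^dim = ≤-trans (≤-trans (m≤m+n T _) T+2L≤dim) (<⇒≤ (n<2^n dim))

  -- With n² points, at most n bad ones amount to an error of at most 1/n.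
  n*n≤2^dim : n * n ≤ 2 ^ dim
  n*n≤2^dim = begin
    n * n           ≤⟨ *-mono-≤ (<⇒≤ (n<2^[1+log₂n] n)) (<⇒≤ (n<2^[1+log₂n] n)) ⟩
    2 ^ L * 2 ^ L   ≡⟨ ^-distribˡ-+-* 2 L L ⟨
    2 ^ (L + L)     ≤⟨ ^-monoʳ-≤ 2 (≤-trans (m≤n+m _ T) T+2L≤dim) ⟩
    2 ^ dim         ∎
    where open ≤-Reasoning

  embed : Fin T → Domain.Carrier D
  embed a = point (Code.enc (finC {T} {dim} T≤2^dim) a)

  embed-injective : ∀ {a a′} → embed a ≡ embed a′ → a ≡ a′
  embed-injective eq = just-injective (trans (sym (Code.dec-enc letters tt)) (trans (cong (Code.dec letters) (point-injective eq)) (Code.dec-enc letters tt)))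
    where
    letters = finC {T} {dim} T≤2^dim

  open AffineHash D embed embed-injective public

  -- fuel is the number of encodable configurations, so a settling run that
  -- halts at all halts within it.
  hashBits entryBits coreBits fuel bufferBits : ℕ
  hashBits = 3 * dim + 3 * dim
  entryBits = nN + (L + hashBits)
  coreBits = L + (hashBits + (hashBits + b * suc entryBits))
  fuel = 2 ^ suc coreBits
  bufferBits = k * suc T

  module Run (coin : Vec Bool dim) where
    r : Domain.Carrier D
    r = point coin

    open Machine G k n b fuel (affine r)
    open Buffered G k n b fuel (affine r) public

    hashC : Code {Hash.Carrier (affine r)} (λ _ → ⊤ × ⊤) hashBits
    hashC = code ×C code

    -- Spending `nN` bits on a nonterminal is generous, but constant for a fixed grammar.
    nN≤2^nN : nN ≤ 2 ^ nN
    nN≤2^nN = <⇒≤ (n<2^n nN)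

    coreC : Code Fits coreBits
    coreC = retractC (λ { (core m i o st) → m , i , o , st }) (λ { (m , i , o , st) → just (core m i o st) })
      (λ { {core m i o st} (p , q , ps) →
           (≤-<-trans p (n<2^[1+log₂n] n) , _ , _ , subst (_≤ b) (length-map _ st) q ,
            All.map (λ le → tt , ≤-<-trans le (n<2^[1+log₂n] n) , _) (Allₚ.map⁻ ps)) , refl })
      (natC L ×C (hashC ×C (hashC ×C listC (finC nN≤2^nN ×C (natC L ×C hashC)) b)))

    stateC : Code Valid (suc (coreBits + bufferBits))
    stateC = maybeC (coreC ×C listC (finC (<⇒≤ (n<2^n T))) k)

    verdict : Maybe (Hash.Carrier (affine r) × Hash.Carrier (affine r)) → Bool
    verdict nothing = false
    verdict (just (i , o)) = does (×ₚ.≡-dec (Domain._≟_ D) (Domain._≟_ D) i o)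

    encode : State → Vec Bool (suc (coreBits + bufferBits))
    encode = Code.enc stateC

    -- A bit string that encodes no state is read as the failed state.
    decode : Vec Bool (suc (coreBits + bufferBits)) → State
    decode v = Code.dec stateC v >>= id

    decode-encode : ∀ {x} → Valid x → decode (encode x) ≡ x
    decode-encode v = cong (_>>= id) (Code.dec-enc stateC v)

    accepts : List (Fin T) → Bool
    accepts w = verdict (execute start w)

  open Run

  space : ℕ
  space = dim + suc (coreBits + bufferBits)

  open Seeded State Valid encode decode decode-encode (λ c a x → x >>= read c a) (λ c x → verdict c (outcome c [] x)) public

-- The streaming algorithm and its acceptance probabilities.

module Algorithm {T : ℕ} (G : Grammar T) (k : ℕ) where

  algorithm : StreamingAlg T
  algorithm = record
    { space  = λ n b → space n b
    ; coins  = λ n b → Domain.dim (D n b)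
    ; init   = λ n b c → store n b c (Run.initial n b c)
    ; step   = λ n b v a _ → stepV n b v a
    ; accept = λ n b → acceptV n b
    }
    where open Parameters G k

  module _ (n b : ℕ) where
    open Parameters G k n b
    open Domain D using (dim; point; point-injective)

    run-accepts : 1 ≤ b → ∀ w c rs → run algorithm n b w (c ∷v rs) ≡ Run.accepts c (toList w)
    run-accepts 1≤b w c rs = trans (cong acceptV (proj₁ fed)) (trans (acceptV-store c _ (proj₂ fed))
      (cong (Run.verdict c) (Run.readAll-outcome c _ w (Run.initial-valid c 1≤b))))
      where
      fed = feed-simulates algorithm n b (Run.Valid c) (store c) (λ x a → x >>= Run.read c a)
        (λ x a _ v → stepV-store c x a v) (λ _ a v → Run.read-valid c a v) _ w rs (Run.initial-valid c 1≤b)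

    tails : List (Vec (Vec Bool dim) n)
    tails = allVec (allBits dim) n

    totalRuns≡ : totalRuns algorithm n b ≡ length (allBits dim) * length tails
    totalRuns≡ = length-extend tails (allBits dim)

    acceptCount≡ : 1 ≤ b → ∀ w → acceptCount algorithm n b w ≡ sum (map (λ c → indicator (Run.accepts c (toList w))) (allBits dim)) * length tails
    acceptCount≡ 1≤b w = sum-extend tails _ _ (λ c rs → cong indicator (run-accepts 1≤b w c rs)) (allBits dim)

    verdict-refl : ∀ c h → Run.verdict c (just (h , h)) ≡ true
    verdict-refl c h = dec-true (×ₚ.≡-dec (Domain._≟_ D) (Domain._≟_ D) h h) refl

    member-accepted : IsLL G k → 1 ≤ b → (w : Vec (Fin T) n) → InLangRankAtMost G b (toList w) → ∀ c → Run.accepts c (toList w) ≡ true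
    member-accepted ll 1≤b w inL c = trans (cong (Run.verdict c)
      (Complete.start-complete G k n b fuel (affine (Run.r c)) (hash-++ (Run.r c)) (hash-letter (Run.r c)) (Run.coreC c) ≤-refl ll
        1≤b (toList w) (≤-reflexive (Vecₚ.length-toList w)) inL)) (verdict-refl c _)

    complete : IsLL G k → 1 ≤ b → (w : Vec (Fin T) n) → InLangRankAtMost G b (toList w) → acceptCount algorithm n b w ≡ totalRuns algorithm n b
    complete ll 1≤b w inL = trans (acceptCount≡ 1≤b w) (trans
      (cong (_* length tails) (trans (sum-const _ 1 (allBits dim) (λ c → cong indicator (member-accepted ll 1≤b w inL c))) (*-identityˡ _)))
      (sym totalRuns≡))

    module F = Machine G k n b fuel (free T)

    module _ (w : List (Fin T)) where

      hashes : (c : Vec Bool dim) → List (Fin T) × List (Fin T) → Hash.Carrier (affine (Run.r c)) × Hash.Carrier (affine (Run.r c))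
      hashes c (i , o) = hash (Run.r c) i , hash (Run.r c) o

      accepts-hash : ∀ c → Run.accepts c w ≡ Run.verdict c (Maybe.map (hashes c) (F.execute F.start w))
      accepts-hash c = cong (Run.verdict c) (Hashing.execute-hash G k n b fuel (affine (Run.r c)) (hash-++ (Run.r c)) (hash-letter (Run.r c)) F.start w)

      accepting : List (Vec Bool dim)
      accepting = filter (λ c → Run.accepts c w Boolₚ.≟ true) (allBits dim)

      collisions : ∀ {i o} → F.execute F.start w ≡ just (i , o) → All (λ c → hash (Run.r c) i ≡ hash (Run.r c) o) accepting
      collisions {i} {o} eq = All.map (λ {c} acc → does-true (×ₚ.≡-dec (Domain._≟_ D) (Domain._≟_ D) _ _)
          (trans (cong (λ x → Run.verdict c (Maybe.map (hashes c) x)) (sym eq)) (trans (sym (accepts-hash c)) acc)))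
        (Allₚ.all-filter (λ c → Run.accepts c w Boolₚ.≟ true) (allBits dim))

      -- The run over words is common to all seeds. If it fails, no seed accepts; otherwise it fixes
      -- one word `o` derivable with rank at most `b`, hence different from `w`, and every accepting
      -- seed is a collision of the two.
      few-accepting : 1 ≤ b → length w ≡ n → ¬ InLangRankAtMost G b w → length accepting ≤ n
      few-accepting 1≤b len w∉ = bound _ refl
        where
        bound : ∀ result → F.execute F.start w ≡ result → length accepting ≤ n
        bound nothing eq = ≤-trans (≤-reflexive (cong length (Listₚ.filter-none (λ c → Run.accepts c w Boolₚ.≟ true)
          (All.universal rejected (allBits dim))))) z≤n
          where
          rejected : ∀ c → Run.accepts c w ≢ true
          rejected c acc with () ← trans (sym acc) (trans (accepts-hash c) (cong (λ x → Run.verdict c (Maybe.map (hashes c) x)) eq))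
        bound (just (i , o)) eq = ≤-trans (<⇒≤ (collide (Correct.execute-sound G k n b fuel [] F.start w
            (Correct.start-invariant G k n b fuel 1≤b) eq))) (≤-reflexive len)
          where
          collide : i ≡ w × length o ≡ length w × InLangRankAtMost G b o → length accepting < length w
          collide (i≡w , len′ , o∈) = subst (_< length w) (length-map point accepting)
            (few-collisions (map point accepting) (Uniqueₚ.map⁺ point-injective (Uniqueₚ.filter⁺ _ (allBits-unique dim)))
              w o (sym len′) (Allₚ.map⁺ (subst (λ i → All (λ c → hash (Run.r c) i ≡ hash (Run.r c) o) accepting) i≡w (collisions eq)))
              (λ w≡o → w∉ (subst (InLangRankAtMost G b) (sym w≡o) o∈)))

    sound : 1 ≤ b → (w : Vec (Fin T) n) → ¬ InLangRankAtMost G b (toList w) → n * acceptCount algorithm n b w ≤ totalRuns algorithm n b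
    sound 1≤b w w∉ = begin
      n * acceptCount algorithm n b w                 ≡⟨ cong (n *_) (acceptCount≡ 1≤b w) ⟩
      n * (sum (map _ (allBits dim)) * length tails)  ≡⟨ *-assoc n _ (length tails) ⟨
      n * sum (map _ (allBits dim)) * length tails    ≤⟨ *-monoˡ-≤ (length tails) (*-monoʳ-≤ n few) ⟩
      n * n * length tails                            ≤⟨ *-monoˡ-≤ (length tails) n*n≤2^dim ⟩
      2 ^ dim * length tails                          ≡⟨ cong (_* length tails) (length-allBits dim) ⟨
      length (allBits dim) * length tails             ≡⟨ totalRuns≡ ⟨
      totalRuns algorithm n b                         ∎
      where
      open ≤-Reasoning
      few : sum (map (λ c → indicator (Run.accepts c (toList w))) (allBits dim)) ≤ n
      few = ≤-trans (≤-reflexive (sum-indicator (λ c → Run.accepts c (toList w)) (allBits dim)))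
                    (few-accepting (toList w) 1≤b (Vecₚ.length-toList w) w∉)

  -- The space bound.

  private
    -- Coefficients of `L` in the bounds on `dim`, on `hashBits` and on `suc entryBits`.
    d h e : ℕ
    d = 2 * T + 4
    h = 3 * d + 3 * d
    e = 1 + (Grammar.nN G + (1 + h))

  constant : ℕ
  constant = d + (1 + ((1 + (h + (h + e))) + k * suc T))

  -- Seed, hashes and counters take O(L) bits and the buffer O(1); only the stack, with `b` entries
  -- of O(L) bits, brings in the factor `b`.
  space-bound : ∀ n b → 1 ≤ b → StreamingAlg.space algorithm n b ≤ constant * b * suc ⌊log₂ n ⌋
  space-bound n b 1≤b = subst (space ≤_) (sym (*-assoc constant b L))
    (plus d (1 + (core′ + k * suc T)) X dim≤
    (plus 1 (core′ + k * suc T) X (fixed 1)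
    (plus core′ (k * suc T) X
      (plus 1 (h + (h + e)) X L≤ (plus h (h + e) X hash≤ (plus h e X hash≤ stack≤)))
      (fixed (k * suc T)))))
    where
    open Parameters G k n b
    open Domain D using (dim)
    X core′ : ℕ
    X = b * L
    core′ = 1 + (h + (h + e))

    -- `L` is a successor, so constants are absorbed even when the logarithm is zero.
    1≤X : 1 ≤ X
    1≤X = *-mono-≤ 1≤b (s≤s z≤n)

    plus : ∀ c c′ Y {x y} → x ≤ c * Y → y ≤ c′ * Y → x + y ≤ (c + c′) * Y
    plus c c′ Y p q = ≤-trans (+-mono-≤ p q) (≤-reflexive (sym (*-distribʳ-+ Y c c′)))

    fixed′ : ∀ c {Y} → 1 ≤ Y → c ≤ c * Y
    fixed′ c le = ≤-trans (≤-reflexive (sym (*-identityʳ c))) (*-monoʳ-≤ c le)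

    fixed : ∀ c → c ≤ c * X
    fixed c = fixed′ c 1≤X

    L≤X : L ≤ X
    L≤X = ≤-trans (≤-reflexive (sym (*-identityˡ L))) (*-monoˡ-≤ L 1≤b)

    dim≤L : dim ≤ d * L
    dim≤L = begin
      dim                                  ≤⟨ proj₂ (proj₂ (domain-of-dim (T + (⌊log₂ n ⌋ + L)))) ⟩
      2 * suc (T + (⌊log₂ n ⌋ + L))        ≡⟨ cong (2 *_) (+-suc T _) ⟨
      2 * (T + (L + L))                    ≡⟨ *-distribˡ-+ 2 T (L + L) ⟩
      2 * T + 2 * (L + L)                  ≡⟨ cong (2 * T +_) four ⟩
      2 * T + 4 * L                        ≤⟨ +-monoˡ-≤ (4 * L) (fixed′ (2 * T) (s≤s z≤n)) ⟩
      2 * T * L + 4 * L                    ≡⟨ *-distribʳ-+ L (2 * T) 4 ⟨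
      d * L                                ∎
      where
      open ≤-Reasoning
      four : 2 * (L + L) ≡ 4 * L
      four = trans (cong (λ x → 2 * (L + x)) (sym (+-identityʳ L))) (sym (*-assoc 2 2 L))

    hash≤L : hashBits ≤ h * L
    hash≤L = plus (3 * d) (3 * d) L triple triple
      where
      triple : 3 * dim ≤ 3 * d * L
      triple = ≤-trans (*-monoʳ-≤ 3 dim≤L) (≤-reflexive (sym (*-assoc 3 d L)))

    dim≤ : dim ≤ d * X
    dim≤ = ≤-trans dim≤L (*-monoʳ-≤ d L≤X)

    hash≤ : hashBits ≤ h * X
    hash≤ = ≤-trans hash≤L (*-monoʳ-≤ h L≤X)

    L≤ : L ≤ 1 * X
    L≤ = ≤-trans L≤X (≤-reflexive (sym (*-identityˡ X)))

    stack≤ : b * suc entryBits ≤ e * X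
    stack≤ = begin
      b * suc entryBits   ≤⟨ *-monoʳ-≤ b (plus 1 (Grammar.nN G + (1 + h)) L (fixed′ 1 (s≤s z≤n)) (plus (Grammar.nN G) (1 + h) L (fixed′ (Grammar.nN G) (s≤s z≤n))
                              (plus 1 h L (≤-reflexive (sym (*-identityˡ L))) hash≤L))) ⟩
      b * (e * L)         ≡⟨ *-assoc b e L ⟨
      b * e * L           ≡⟨ cong (_* L) (*-comm b e) ⟩
      e * b * L           ≡⟨ *-assoc e b L ⟩
      e * X               ∎
      where open ≤-Reasoning

theorem3 : ∀ {T : ℕ} (G : Grammar T) (k : ℕ) → IsLL G k →
    Σ (StreamingAlg T) λ M → Σ ℕ λ C →
    (∀ n b → 1 ≤ b → StreamingAlg.space M n b ≤ C * b * suc ⌊log₂ n ⌋)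
    × (∀ n b → 1 ≤ b → (w : Vec (Fin T) n) →
    InLangRankAtMost G b (toList w) →
    acceptCount M n b w ≡ totalRuns M n b)
    × (∀ n b → 1 ≤ b → 1 ≤ n → (w : Vec (Fin T) n) →
    ¬ InLangRankAtMost G b (toList w) →
    n * acceptCount M n b w ≤ totalRuns M n b)
theorem3 G k ll = algorithm , constant , space-bound
  , (λ n b 1≤b w → complete n b ll 1≤b w)
  , (λ n b 1≤b _ w → sound n b 1≤b w)
  where open Algorithm G k
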